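{- For each positive integer $n$, there is an edge-ordered graph $G$ on $N = 2^{100n^2(\log_2 n)^2}$ vertices such that, for every two-coloring of the edges of $G$, there exists a monochromatic subgraph of $G$ containing a copy of every $n$-vertex edge-ordered graph $H$.
   Context: An edge-ordered graph is a finite simple graph together with a total ordering of its edges (equivalently, an assignment of distinct integer labels to its edges). Two edge-ordered graphs are equivalent if there is a graph isomorphism between them preserving the ordering of the edges. An edge-ordered graph $G$ contains a copy of an edge-ordered graph $H$ if some subgraph of $G$, with the edge-ordering inherited from $G$, is equivalent to $H$. -}

module Defs where

open import Data.Nat using (ℕ; suc; _+_; _*_; _^_; _≤_; _<_)
open import Data.Fin using (Fin)
open import Data.Bool using (Bool; true; false)
open import Data.Product using (_×_; Σ; ∃-syntax)
open import Data.Sum using (_⊎_)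
open import Relation.Nullary using (¬_)
open import Relation.Binary.PropositionalEquality using (_≡_)
open import Function.Definitions using (Injective)

record EOGraph (V : ℕ) : Set where
  field
    adj     : Fin V → Fin V → Bool
    adj-sym : ∀ u v → adj u v ≡ adj v u
    adj-irr : ∀ u → adj u u ≡ false
    lab     : Fin V → Fin V → ℕ
    lab-sym : ∀ u v → lab u v ≡ lab v u
    lab-inj : ∀ u v x y → adj u v ≡ true → adj x y ≡ true →
              lab u v ≡ lab x y → (u ≡ x × v ≡ y) ⊎ (u ≡ y × v ≡ x)

open EOGraph public

-- A two-colouring of the edges of a graph on Fin V, given as a symmetric
-- function on pairs of vertices (its values on non-edges are irrelevant).
record TwoColouring (V : ℕ) : Set where
  field
    col     : Fin V → Fin V → Bool
    col-sym : ∀ u v → col u v ≡ col v u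

open TwoColouring public

-- G contains a copy of H all of whose edges have colour b under c:
-- an injective vertex map sending edges of H to edges of G of colour b
-- and preserving the edge ordering.  (Since edge labels are distinct,
-- preserving strict order makes the image subgraph, with the order
-- inherited from G, equivalent to H.)
MonoCopy : {n M : ℕ} → EOGraph M → TwoColouring M → Bool → EOGraph n → Set
MonoCopy {n} {M} G c b H =
  Σ (Fin n → Fin M) λ f → (Injective _≡_ _≡_ f
    × (∀ u v → adj H u v ≡ true → adj G (f u) (f v) ≡ true)
    × (∀ u v → adj H u v ≡ true → col c (f u) (f v) ≡ b)
    × (∀ u v x y → adj H u v ≡ true → adj H x y ≡ true →
         lab H u v < lab H x y → lab G (f u) (f v) < lab G (f x) (f y)))

-- M ≤ 2^(100 n² (log₂ n)²), expressed exactly over ℕ (for n ≥ 1):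
-- for every rational p/q > log₂ n (i.e. n^q < 2^p), M^(q²) ≤ 2^(100 n² p²).
AtMostN : ℕ → ℕ → Set
AtMostN n M = ∀ p q → 0 < q → n ^ q < 2 ^ p → M ^ (q * q) ≤ 2 ^ (100 * (n * n) * (p * p))

IsFloorN : ℕ → ℕ → Set
IsFloorN n M = AtMostN n M × ¬ AtMostN n (suc M)

{-# OPTIONS --safe #-}
module Submission where

-- Vertices of a complete graph on N = Q² vertices are pairs (a , b) of residues mod Q, and the label of an edge
-- is the block containing a a′ + b + b′; by a second moment computation, for every set X almost every vertex has
-- about the expected number of neighbours of each label in X. A label is a string of digits, compared lexicographically.
-- If a greedy embedding of a pattern H₁ into red, using the digits after a common prefix, fails, then it yields two
-- large sets A, B and a digit such that red edges continuing the prefix by this digit are sparse between A and B.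
-- Recursing in A and then, with the prefix found there, in B gives n large sets which are pairwise red-sparse
-- for one and the same prefix; the depth of the recursion is only log n, although it uses up to 2n digits. Since
-- labels with that prefix are mostly blue between these sets, every pattern embeds in blue with the last digit,
-- choosing vertices whose neighbourhoods inherit the red sparsity. So if blue is not universal, red contains every H₁.

open import Defs
open import Data.Nat
open import Data.Nat.Properties
open import Data.Nat.DivMod
open import Data.Nat.Divisibility using (_∤_; divides; divides-refl; 1∣_; *-monoʳ-∣)
open import Data.Nat.Tactic.RingSolver using (solve-∀)
open import Data.Bool using (Bool; true; false; _∧_; not; if_then_else_; T)
open import Data.Fin as Fin using (Fin; toℕ; fromℕ<)
open import Data.Fin.Properties using (toℕ<n; toℕ-injective; toℕ-fromℕ<)
open import Data.Product using (_×_; Σ; ∃-syntax; _,_; proj₁; proj₂)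
open import Data.Sum as Sum using (_⊎_; inj₁; inj₂)
open import Data.Vec using (Vec; []; _∷_; lookup; tabulate)
open import Data.Vec.Properties using (lookup∘tabulate)
open import Function.Definitions using (Injective)
open import Relation.Binary.Definitions using (tri<; tri≈; tri>)
open import Relation.Binary.PropositionalEquality
open import Relation.Nullary using (¬_; Dec; yes; no; contradiction)

-- Finite sums and indicators

-- The exponent can be read off the sizes. A digit has to encode one of `n * n` ranks, so strings of
-- O(n) digits give `L` = 2^O(n log n) labels, each of density 1 / `L`. A blue embedding loses a
-- factor `2 * L` per vertex, and red must be rarer than a single label throughout, so sparsity 1 /
-- t with t = 2^O(n log n) is required. One level of the recursion costs about t ^ n, and log n
-- levels give 2^O(n² (log n)²); producing the sets one by one would take n levels instead. The
-- leading coefficient obtained is 32; the constant 100 is nearly exhausted at n = 2, where the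
-- exponent is 376 out of 400. The colouring is chosen after the labelling, so the red
-- neighbourhoods met later are arbitrary sets. Degree regularity is therefore needed for every set
-- X, and it follows from codegrees alone: for most pairs of vertices, having label τ towards a
-- third vertex are exactly independent events.

∑ : ℕ → (ℕ → ℕ) → ℕ
∑ zero    f = 0
∑ (suc n) f = ∑ n f + f n

∑-cong : ∀ n {f g} → (∀ i → i < n → f i ≡ g i) → ∑ n f ≡ ∑ n g
∑-cong zero    e = refl
∑-cong (suc n) e = cong₂ _+_ (∑-cong n (λ i p → e i (m≤n⇒m≤1+n p))) (e n ≤-refl)

∑-mono : ∀ n {f g} → (∀ i → i < n → f i ≤ g i) → ∑ n f ≤ ∑ n g
∑-mono zero    e = z≤n
∑-mono (suc n) e = +-mono-≤ (∑-mono n (λ i p → e i (m≤n⇒m≤1+n p))) (e n ≤-refl)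

∑-+ : ∀ n f g → ∑ n (λ i → f i + g i) ≡ ∑ n f + ∑ n g
∑-+ zero    f g = refl
∑-+ (suc n) f g rewrite ∑-+ n f g = interchange (∑ n f) (∑ n g) (f n) (g n)
  where
  interchange : ∀ a b c d → (a + b) + (c + d) ≡ (a + c) + (b + d)
  interchange = solve-∀

∑-*ˡ : ∀ n c f → ∑ n (λ i → c * f i) ≡ c * ∑ n f
∑-*ˡ zero    c f = sym (*-zeroʳ c)
∑-*ˡ (suc n) c f rewrite ∑-*ˡ n c f = sym (*-distribˡ-+ c (∑ n f) (f n))

∑-*ʳ : ∀ n c f → ∑ n (λ i → f i * c) ≡ ∑ n f * c
∑-*ʳ n c f = trans (∑-cong n (λ i _ → *-comm (f i) c)) (trans (∑-*ˡ n c f) (*-comm c (∑ n f)))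

∑-const : ∀ n c → ∑ n (λ _ → c) ≡ n * c
∑-const zero    c = refl
∑-const (suc n) c rewrite ∑-const n c = +-comm (n * c) c

∑-≤ : ∀ n c {f} → (∀ i → i < n → f i ≤ c) → ∑ n f ≤ n * c
∑-≤ n c e = ≤-trans (∑-mono n e) (≤-reflexive (∑-const n c))

∑-swap : ∀ m n (f : ℕ → ℕ → ℕ) → ∑ m (λ i → ∑ n (f i)) ≡ ∑ n (λ j → ∑ m (λ i → f i j))
∑-swap zero    n f = sym (trans (∑-const n 0) (*-zeroʳ n))
∑-swap (suc m) n f rewrite ∑-swap m n f = sym (∑-+ n (λ j → ∑ m (λ i → f i j)) (f m))

∑-* : ∀ n f g → ∑ n f * ∑ n g ≡ ∑ n (λ i → ∑ n (λ j → f i * g j))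
∑-* n f g = trans (sym (∑-*ʳ n (∑ n g) f)) (∑-cong n (λ i _ → sym (∑-*ˡ n (f i) g)))

term≤∑ : ∀ n f {i} → i < n → f i ≤ ∑ n f
term≤∑ (suc n) f {i} i<1+n with m≤n⇒m<n∨m≡n (s≤s⁻¹ i<1+n)
... | inj₁ i<n  = ≤-trans (term≤∑ n f i<n) (m≤m+n _ _)
... | inj₂ refl = m≤n+m _ _

∑-strict : ∀ n {f g} → (∀ i → i < n → f i ≤ g i) → ∀ {i} → i < n → f i < g i → ∑ n f < ∑ n g
∑-strict (suc n) e {i} i<1+n lt with m≤n⇒m<n∨m≡n (s≤s⁻¹ i<1+n)
... | inj₁ i<n  = +-mono-<-≤ (∑-strict n (λ j p → e j (m≤n⇒m≤1+n p)) i<n lt) (e n ≤-refl)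
... | inj₂ refl = +-mono-≤-< (∑-mono n (λ j p → e j (m≤n⇒m≤1+n p))) lt

∑-find : ∀ n f g → ∑ n f < ∑ n g → ∃[ i ] i < n × f i < g i
∑-find (suc n) f g lt with f n <? g n
... | yes p = n , ≤-refl , p
... | no ¬p with ∑ n f <? ∑ n g
...   | yes q = let (i , i<n , r) = ∑-find n f g q in i , m≤n⇒m≤1+n i<n , r
...   | no ¬q = contradiction (+-mono-≤ (≮⇒≥ ¬q) (≮⇒≥ ¬p)) (<⇒≱ lt)

∑-head : ∀ n f → ∑ (suc n) f ≡ f 0 + ∑ n (λ i → f (suc i))
∑-head zero    f = +-comm 0 (f 0)
∑-head (suc n) f rewrite ∑-head n f = +-assoc (f 0) _ _

∑-split : ∀ m n f → ∑ (m + n) f ≡ ∑ m f + ∑ n (λ i → f (m + i))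
∑-split m zero    f rewrite +-identityʳ m = sym (+-identityʳ _)
∑-split m (suc n) f rewrite +-suc m n | ∑-split m n f = +-assoc (∑ m f) _ _

∑-product : ∀ a b f → ∑ (a * b) f ≡ ∑ a (λ i → ∑ b (λ j → f (i * b + j)))
∑-product zero    b f = refl
∑-product (suc a) b f rewrite +-comm b (a * b) | ∑-split (a * b) b f = cong (_+ ∑ b (λ j → f (a * b + j))) (∑-product a b f)

∑-shift : ∀ n f → (∀ i → f (i + n) ≡ f i) → ∀ h → ∑ n (λ i → f (h + i)) ≡ ∑ n f
∑-shift n f per zero    = refl
∑-shift n f per (suc h) = trans step (∑-shift n f per h)
  where
  step : ∑ n (λ i → f (suc h + i)) ≡ ∑ n (λ i → f (h + i))
  step = +-cancelˡ-≡ (f h) _ _ (begin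
    f h + ∑ n (λ i → f (suc h + i))            ≡⟨ cong₂ _+_ (cong f (sym (+-identityʳ h))) (∑-cong n (λ i _ → cong f (sym (+-suc h i)))) ⟩
    f (h + 0) + ∑ n (λ i → f (h + suc i))      ≡⟨ sym (∑-head n (λ i → f (h + i))) ⟩
    ∑ n (λ i → f (h + i)) + f (h + n)          ≡⟨ cong (∑ n (λ i → f (h + i)) +_) (per h) ⟩
    ∑ n (λ i → f (h + i)) + f h                ≡⟨ +-comm _ (f h) ⟩
    f h + ∑ n (λ i → f (h + i)) ∎)
    where open ≡-Reasoning

⟦_⟧ : Bool → ℕ
⟦ true ⟧  = 1
⟦ false ⟧ = 0

⟦⟧≤1 : ∀ b → ⟦ b ⟧ ≤ 1
⟦⟧≤1 true  = ≤-refl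
⟦⟧≤1 false = z≤n

⟦∧⟧ : ∀ a b → ⟦ a ∧ b ⟧ ≡ ⟦ a ⟧ * ⟦ b ⟧
⟦∧⟧ true  b = sym (*-identityˡ _)
⟦∧⟧ false b = refl

-- Applied after `∑-find` to sums weighted by membership, this turns an average over a set into an
-- element of that set.
⟦⟧-<⇒ : ∀ a {x y} → ⟦ a ⟧ * x < ⟦ a ⟧ * y → a ≡ true × x < y
⟦⟧-<⇒ true  {x} {y} lt = refl , subst₂ _<_ (*-identityˡ x) (*-identityˡ y) lt

∧-true⁻ : ∀ {a b} → a ∧ b ≡ true → a ≡ true × b ≡ true
∧-true⁻ {true} {true} _ = refl , refl

∧-true⁺ : ∀ {a b} → a ≡ true → b ≡ true → a ∧ b ≡ true
∧-true⁺ refl refl = refl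

≡ᵇ-true : ∀ {m n} → m ≡ n → (m ≡ᵇ n) ≡ true
≡ᵇ-true {zero}  refl = refl
≡ᵇ-true {suc m} refl = ≡ᵇ-true {m} refl

≡ᵇ-false : ∀ {m n} → m ≢ n → (m ≡ᵇ n) ≡ false
≡ᵇ-false {zero}  {zero}  ne = contradiction refl ne
≡ᵇ-false {zero}  {suc n} ne = refl
≡ᵇ-false {suc m} {zero}  ne = refl
≡ᵇ-false {suc m} {suc n} ne = ≡ᵇ-false (λ e → ne (cong suc e))

≡ᵇ-true⁻ : ∀ {m n} → (m ≡ᵇ n) ≡ true → m ≡ n
≡ᵇ-true⁻ {m} {n} e = ≡ᵇ⇒≡ m n (subst T (sym e) _)

≡ᵇ-comm : ∀ m n → (m ≡ᵇ n) ≡ (n ≡ᵇ m)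
≡ᵇ-comm zero    zero    = refl
≡ᵇ-comm zero    (suc n) = refl
≡ᵇ-comm (suc m) zero    = refl
≡ᵇ-comm (suc m) (suc n) = ≡ᵇ-comm m n

∑-δ : ∀ n {τ} → τ < n → ∑ n (λ i → ⟦ i ≡ᵇ τ ⟧) ≡ 1
∑-δ (suc n) {τ} τ<1+n with m≤n⇒m<n∨m≡n (s≤s⁻¹ τ<1+n)
... | inj₁ τ<n  = cong₂ _+_ (∑-δ n τ<n) (cong ⟦_⟧ (≡ᵇ-false (>⇒≢ τ<n)))
... | inj₂ refl = cong₂ _+_
  (trans (∑-cong n (λ i i<n → cong ⟦_⟧ (≡ᵇ-false (<⇒≢ i<n)))) (trans (∑-const n 0) (*-zeroʳ n)))
  (cong ⟦_⟧ (≡ᵇ-true {n} refl))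

-- The pseudorandom labelling

halve : ∀ n → ∃[ m ] (n ≡ 2 * m ⊎ n ≡ suc (2 * m))
halve zero = 0 , inj₁ refl
halve (suc n) with halve n
... | m , inj₁ e = m , inj₂ (cong suc e)
... | m , inj₂ e = suc m , inj₁ (trans (cong suc e) (sym (*-suc 2 m)))

-- Hensel lifting: an inverse modulo 2 ^ r still works modulo 2 ^ suc r if `w` is even, and
-- otherwise does so after adding 2 ^ r, because the number inverted is odd.
odd-inverse : ∀ m r → ∃[ h ] ∃[ w ] suc (2 * m) * h ≡ 1 + w * 2 ^ r
odd-inverse m zero = 1 , 2 * m , refl
odd-inverse m (suc r) with odd-inverse m r
... | h , w , e with halve w
...   | w′ , inj₁ e′ = h , w′ , trans e (cong suc (trans (cong (_* 2 ^ r) e′) (lem w′ (2 ^ r))))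
  where
  lem : ∀ w p → 2 * w * p ≡ w * (2 * p)
  lem = solve-∀
...   | w′ , inj₂ e′ = h + 2 ^ r , suc (w′ + m) , (begin
        suc (2 * m) * (h + 2 ^ r)               ≡⟨ *-distribˡ-+ (suc (2 * m)) h (2 ^ r) ⟩
        suc (2 * m) * h + suc (2 * m) * 2 ^ r   ≡⟨ cong (_+ suc (2 * m) * 2 ^ r) (trans e (cong (λ v → 1 + v * 2 ^ r) e′)) ⟩
        1 + suc (2 * w′) * 2 ^ r + suc (2 * m) * 2 ^ r ≡⟨ lem w′ m (2 ^ r) ⟩
        1 + suc (w′ + m) * (2 * 2 ^ r)          ∎)
  where
  open ≡-Reasoning
  lem : ∀ w m p → 1 + (1 + 2 * w) * p + (1 + 2 * m) * p ≡ 1 + (1 + (w + m)) * (2 * p)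
  lem = solve-∀

-- The power of two in u properly divides 2 ^ s. It is divided out of both sides until an odd number
-- remains, which is inverted modulo 2 ^ r.
congruence-solvable : ∀ r s u → 2 ^ s ∤ u → ∃[ h ] ∃[ w ] u * h ≡ 2 ^ s + w * (2 ^ r * 2 ^ s)
congruence-solvable r zero u ∤u = contradiction (1∣ u) ∤u
congruence-solvable r (suc s) u ∤u with halve u
... | v , inj₁ refl = let (h , w , e) = congruence-solvable r s v (λ d → ∤u (*-monoʳ-∣ 2 d)) in
  h , w , trans (*-assoc 2 v h) (trans (cong (2 *_) e) (lem (2 ^ r) (2 ^ s) w))
  where
  lem : ∀ p q w → 2 * (q + w * (p * q)) ≡ 2 * q + w * (p * (2 * q))
  lem = solve-∀
... | v , inj₂ refl = let (h , w , e) = odd-inverse v r in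
  h * 2 ^ suc s , w , trans (sym (*-assoc (suc (2 * v)) h _)) (trans (cong (_* 2 ^ suc s) e) (lem (2 ^ r) (2 ^ suc s) w))
  where
  lem : ∀ p q w → (1 + w * p) * q ≡ q + w * (p * q)
  lem = solve-∀

card : ℕ → (ℕ → Bool) → ℕ
card N X = ∑ N (λ x → ⟦ X x ⟧)

card≤ : ∀ N X → card N X ≤ N
card≤ N X = ≤-trans (∑-≤ N 1 (λ x _ → ⟦⟧≤1 (X x))) (≤-reflexive (*-identityʳ N))

square-diff : ∀ a b → ∣ a - b ∣ * ∣ a - b ∣ + 2 * (a * b) ≡ a * a + b * b
square-diff a b with ≤-total a b
... | inj₁ a≤b with m≤n⇒∃[o]m+o≡n a≤b
...   | o , refl rewrite ∣m-m+n∣≡n a o = lem a o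
  where
  lem : ∀ a o → o * o + 2 * (a * (a + o)) ≡ a * a + (a + o) * (a + o)
  lem = solve-∀
square-diff a b | inj₂ b≤a with m≤n⇒∃[o]m+o≡n b≤a
...   | o , refl rewrite trans (∣-∣-comm (b + o) b) (∣m-m+n∣≡n b o) = lem b o
  where
  lem : ∀ b o → o * o + 2 * ((b + o) * b) ≡ (b + o) * (b + o) + b * b
  lem = solve-∀

module Labelling
  (L S : ℕ) .{{_ : NonZero L}} .{{_ : NonZero S}}
  (solvable : ∀ u → S ∤ u → ∃[ h ] ∃[ w ] u * h ≡ S + w * (L * S))
  where

  Q : ℕ
  Q = L * S

  instance
    Q≢0 : NonZero Q
    Q≢0 = m*n≢0 L S

  N : ℕ
  N = Q * Q

  class : ℕ → ℕ
  class t = t / S % L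

  δ : ℕ → ℕ → ℕ
  δ τ t = ⟦ class t ≡ᵇ τ ⟧

  class-+S : ∀ t j → class (t + j * S) ≡ (t / S + j) % L
  class-+S t j = cong (_% L) (trans (+-distrib-/-∣ʳ t (divides-refl j)) (cong (t / S +_) (m*n/n≡m j S)))

  δ-periodic : ∀ τ t w → δ τ (t + w * Q) ≡ δ τ t
  δ-periodic τ t w = cong (λ c → ⟦ c ≡ᵇ τ ⟧) (begin
    class (t + w * (L * S))  ≡⟨ cong (λ q → class (t + q)) (sym (*-assoc w L S)) ⟩
    class (t + w * L * S)    ≡⟨ class-+S t (w * L) ⟩
    (t / S + w * L) % L      ≡⟨ [m+kn]%n≡m%n (t / S) w L ⟩
    class t                  ∎)
    where open ≡-Reasoning

  δ-periodic₁ : ∀ τ t → δ τ (t + Q) ≡ δ τ t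
  δ-periodic₁ τ t = trans (cong (λ q → δ τ (t + q)) (sym (*-identityˡ Q))) (δ-periodic τ t 1)

  ∑-classes : ∀ {τ} → τ < L → ∀ t → ∑ L (λ j → δ τ (t + j * S)) ≡ 1
  ∑-classes {τ} τ<L t = begin
    ∑ L (λ j → δ τ (t + j * S))                  ≡⟨ ∑-cong L (λ j _ → cong (λ c → ⟦ c ≡ᵇ τ ⟧) (class-+S t j)) ⟩
    ∑ L (λ j → ⟦ (t / S + j) % L ≡ᵇ τ ⟧)         ≡⟨ ∑-shift L (λ j → ⟦ j % L ≡ᵇ τ ⟧) (λ j → cong (λ c → ⟦ c ≡ᵇ τ ⟧) ([m+n]%n≡m%n j L)) (t / S) ⟩
    ∑ L (λ j → ⟦ j % L ≡ᵇ τ ⟧)                   ≡⟨ ∑-cong L (λ j j<L → cong (λ c → ⟦ c ≡ᵇ τ ⟧) (m<n⇒m%n≡m j<L)) ⟩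
    ∑ L (λ j → ⟦ j ≡ᵇ τ ⟧)                       ≡⟨ ∑-δ L τ<L ⟩
    1                                            ∎
    where open ≡-Reasoning

  ∑-class : ∀ {τ} → τ < L → ∀ t → ∑ Q (λ b → δ τ (t + b)) ≡ S
  ∑-class {τ} τ<L t = begin
    ∑ Q (λ b → δ τ (t + b))                       ≡⟨ ∑-shift Q (δ τ) (δ-periodic₁ τ) t ⟩
    ∑ Q (δ τ)                                     ≡⟨ ∑-product L S (δ τ) ⟩
    ∑ L (λ i → ∑ S (λ j → δ τ (i * S + j)))       ≡⟨ ∑-swap L S (λ i j → δ τ (i * S + j)) ⟩
    ∑ S (λ j → ∑ L (λ i → δ τ (i * S + j)))       ≡⟨ ∑-cong S (λ j _ → trans (∑-cong L (λ i _ → cong (δ τ) (+-comm (i * S) j))) (∑-classes τ<L j)) ⟩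
    ∑ S (λ _ → 1)                                 ≡⟨ trans (∑-const S 1) (*-identityʳ S) ⟩
    S                                             ∎
    where open ≡-Reasoning

  -- If u h ≡ S mod Q then replacing a by a + h moves c + u a to the next block, so all L blocks are hit equally often.
  ∑-progression : ∀ {τ} → τ < L → ∀ {u} → S ∤ u → ∀ c → ∑ Q (λ a → δ τ (c + u * a)) ≡ S
  ∑-progression {τ} τ<L {u} S∤u c = *-cancelˡ-≡ _ _ L (begin
    L * P c                                                     ≡⟨ sym (∑-const L (P c)) ⟩
    ∑ L (λ _ → P c)                                             ≡⟨ ∑-cong L (λ j _ → sym (P-shift j)) ⟩
    ∑ L (λ j → ∑ Q (λ a → δ τ (c + j * S + u * a)))             ≡⟨ ∑-swap L Q (λ j a → δ τ (c + j * S + u * a)) ⟩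
    ∑ Q (λ a → ∑ L (λ j → δ τ (c + j * S + u * a)))             ≡⟨ ∑-cong Q (λ a _ → trans (∑-cong L (λ j _ → cong (δ τ) (swap c (j * S) (u * a)))) (∑-classes τ<L (c + u * a))) ⟩
    ∑ Q (λ _ → 1)                                               ≡⟨ trans (∑-const Q 1) (*-identityʳ Q) ⟩
    L * S                                                       ∎)
    where
    open ≡-Reasoning
    P : ℕ → ℕ
    P c = ∑ Q (λ a → δ τ (c + u * a))
    swap : ∀ a b c → a + b + c ≡ a + c + b
    swap = solve-∀
    h = proj₁ (solvable u S∤u)
    w = proj₁ (proj₂ (solvable u S∤u))
    uh : u * h ≡ S + w * Q
    uh = proj₂ (proj₂ (solvable u S∤u))
    rearrange : ∀ c x y z → c + (x + y + z) ≡ (c + x + z) + y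
    rearrange = solve-∀
    move : ∀ c a → δ τ (c + u * (h + a)) ≡ δ τ (c + S + u * a)
    move c a = begin
      δ τ (c + u * (h + a))           ≡⟨ cong (λ v → δ τ (c + v)) (trans (*-distribˡ-+ u h a) (cong (_+ u * a) uh)) ⟩
      δ τ (c + (S + w * Q + u * a))   ≡⟨ cong (δ τ) (rearrange c S (w * Q) (u * a)) ⟩
      δ τ (c + S + u * a + w * Q)     ≡⟨ δ-periodic τ _ w ⟩
      δ τ (c + S + u * a)             ∎
    period : ∀ c a → δ τ (c + u * (a + Q)) ≡ δ τ (c + u * a)
    period c a = trans (cong (δ τ) (trans (cong (c +_) (*-distribˡ-+ u a Q)) (sym (+-assoc c _ _)))) (δ-periodic τ _ u)
    P-step : ∀ c → P (c + S) ≡ P c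
    P-step c = trans (∑-cong Q (λ a _ → sym (move c a)))
                     (∑-shift Q (λ a → δ τ (c + u * a)) (period c) h)
    P-shift : ∀ j → P (c + j * S) ≡ P c
    P-shift zero    = cong P (+-identityʳ c)
    P-shift (suc j) = trans (cong P (trans (cong (c +_) (+-comm S (j * S))) (sym (+-assoc c _ _)))) (trans (P-step _) (P-shift j))

  -- A vertex x < Q² stands for the pair (x / Q , x % Q), and the label of (a , b)(a′ , b′) is
  -- the block of length S of ℤ/Q containing a a′ + b + b′.
  label : ℕ → ℕ → ℕ
  label x y = class (x / Q * (y / Q) + (x % Q + y % Q))

  label-sym : ∀ x y → label x y ≡ label y x
  label-sym x y = cong class (cong₂ _+_ (*-comm (x / Q) (y / Q)) (+-comm (x % Q) (y % Q)))

  ∑-grid : ∀ (F : ℕ → ℕ → ℕ) → ∑ N (λ i → F (i / Q) (i % Q)) ≡ ∑ Q (λ a → ∑ Q (F a))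
  ∑-grid F = trans (∑-product Q Q _) (∑-cong Q (λ a _ → ∑-cong Q (λ b b<Q → cong₂ F (quot a b<Q) (rem a b<Q))))
    where
    quot : ∀ a {b} → b < Q → (a * Q + b) / Q ≡ a
    quot a {b} b<Q = trans (+-distrib-/-∣ˡ {a * Q} b {Q} (divides-refl a)) (trans (cong₂ _+_ (m*n/n≡m a Q) (m<n⇒m/n≡0 b<Q)) (+-identityʳ a))
    rem : ∀ a {b} → b < Q → (a * Q + b) % Q ≡ b
    rem a {b} b<Q = trans (cong (_% Q) (+-comm (a * Q) b)) (trans ([m+kn]%n≡m%n b a Q) (m<n⇒m%n≡m b<Q))

  -- The exceptional pairs: if the first coordinates differ by a multiple of S, the progression
  -- argument does not apply and the codegree is only bounded by the degree.
  near : ℕ → ℕ → Bool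
  near x y = x / Q % S ≡ᵇ y / Q % S

  near-count : ∀ x → ∑ N (λ y → ⟦ near x y ⟧) ≡ Q * L
  near-count x = begin
    ∑ N (λ y → ⟦ near x y ⟧)                                 ≡⟨ ∑-grid (λ a _ → ⟦ x / Q % S ≡ᵇ a % S ⟧) ⟩
    ∑ Q (λ a → ∑ Q (λ _ → ⟦ x / Q % S ≡ᵇ a % S ⟧))           ≡⟨ ∑-cong Q (λ a _ → ∑-const Q _) ⟩
    ∑ Q (λ a → Q * ⟦ x / Q % S ≡ᵇ a % S ⟧)                   ≡⟨ ∑-*ˡ Q Q _ ⟩
    Q * ∑ Q (λ a → ⟦ x / Q % S ≡ᵇ a % S ⟧)                   ≡⟨ cong (Q *_) (∑-product L S _) ⟩
    Q * ∑ L (λ i → ∑ S (λ j → ⟦ x / Q % S ≡ᵇ (i * S + j) % S ⟧)) ≡⟨ cong (Q *_) (trans (∑-cong L (λ i _ → inner i)) (trans (∑-const L 1) (*-identityʳ L))) ⟩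
    Q * L ∎
    where
    open ≡-Reasoning
    rem : ∀ i {j} → j < S → (i * S + j) % S ≡ j
    rem i {j} j<S = trans (cong (_% S) (+-comm (i * S) j)) (trans ([m+kn]%n≡m%n j i S) (m<n⇒m%n≡m j<S))
    inner : ∀ i → ∑ S (λ j → ⟦ x / Q % S ≡ᵇ (i * S + j) % S ⟧) ≡ 1
    inner i = trans (∑-cong S (λ j j<S → cong ⟦_⟧ (trans (cong (x / Q % S ≡ᵇ_) (rem i j<S)) (≡ᵇ-comm (x / Q % S) j))))
                    (∑-δ S (m%n<n (x / Q) S))

  module _ {τ} (τ<L : τ < L) where

    I : ℕ → ℕ → ℕ
    I x y = ⟦ label x y ≡ᵇ τ ⟧

    degree : ∀ x → ∑ N (I x) ≡ Q * S
    degree x = begin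
      ∑ N (I x)                                                ≡⟨ ∑-grid (λ a b → δ τ (x / Q * a + (x % Q + b))) ⟩
      ∑ Q (λ a → ∑ Q (λ b → δ τ (x / Q * a + (x % Q + b))))    ≡⟨ ∑-cong Q (λ a _ → trans (∑-cong Q (λ b _ → cong (δ τ) (sym (+-assoc (x / Q * a) (x % Q) b)))) (∑-class τ<L _)) ⟩
      ∑ Q (λ _ → S)                                            ≡⟨ ∑-const Q S ⟩
      Q * S                                                    ∎
      where open ≡-Reasoning

    -- After the shift t = c a + b the second factor no longer depends on a, while the first runs
    -- through a progression with step u. Hence the sum over a is S for each t.
    codegree-pairs : ∀ {u} → S ∤ u → ∀ c d d′ →
      ∑ Q (λ a → ∑ Q (λ b → δ τ ((c + u) * a + (d + b)) * δ τ (c * a + (d′ + b)))) ≡ S * S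
    codegree-pairs {u} S∤u c d d′ = begin
      ∑ Q (λ a → ∑ Q (λ b → δ τ ((c + u) * a + (d + b)) * δ τ (c * a + (d′ + b))))
        ≡⟨ ∑-cong Q (λ a _ → ∑-cong Q (λ b _ → cong₂ _*_ (cong (δ τ) (arr₁ c u a d b)) (cong (δ τ) (arr₂ c a d′ b)))) ⟩
      ∑ Q (λ a → ∑ Q (λ b → F a (c * a + b)))
        ≡⟨ ∑-cong Q (λ a _ → ∑-shift Q (F a) (F-periodic a) (c * a)) ⟩
      ∑ Q (λ a → ∑ Q (λ b → F a b))
        ≡⟨ ∑-swap Q Q F ⟩
      ∑ Q (λ b → ∑ Q (λ a → F a b))
        ≡⟨ ∑-cong Q (λ b _ → trans (∑-*ʳ Q (δ τ (b + d′)) (λ a → δ τ (b + d + u * a))) (cong (_* δ τ (b + d′)) (∑-progression τ<L S∤u (b + d)))) ⟩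
      ∑ Q (λ b → S * δ τ (b + d′))
        ≡⟨ ∑-*ˡ Q S (λ b → δ τ (b + d′)) ⟩
      S * ∑ Q (λ b → δ τ (b + d′))
        ≡⟨ cong (S *_) (trans (∑-cong Q (λ b _ → cong (δ τ) (+-comm b d′))) (∑-class τ<L d′)) ⟩
      S * S ∎
      where
      open ≡-Reasoning
      F : ℕ → ℕ → ℕ
      F a t = δ τ (t + d + u * a) * δ τ (t + d′)
      arr₁ : ∀ c u a d b → (c + u) * a + (d + b) ≡ c * a + b + d + u * a
      arr₁ = solve-∀
      arr₂ : ∀ c a d′ b → c * a + (d′ + b) ≡ c * a + b + d′
      arr₂ = solve-∀
      arr₃ : ∀ t q d v → t + q + d + v ≡ t + d + v + q
      arr₃ = solve-∀
      arr₄ : ∀ t q d → t + q + d ≡ t + d + q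
      arr₄ = solve-∀
      F-periodic : ∀ a t → F a (t + Q) ≡ F a t
      F-periodic a t = cong₂ _*_ (trans (cong (δ τ) (arr₃ t Q d (u * a))) (δ-periodic₁ τ _))
                                 (trans (cong (δ τ) (arr₄ t Q d′)) (δ-periodic₁ τ _))

    codegree-far : ∀ x y → x / Q ≤ y / Q → x / Q % S ≢ y / Q % S → ∑ N (λ v → I y v * I x v) ≡ S * S
    codegree-far x y x≤y ne with m≤n⇒∃[o]m+o≡n x≤y
    ... | u , e = trans (∑-grid (λ a b → δ τ (y / Q * a + (y % Q + b)) * δ τ (x / Q * a + (x % Q + b))))
        (trans (cong (λ q → ∑ Q (λ a → ∑ Q (λ b → δ τ (q * a + (y % Q + b)) * δ τ (x / Q * a + (x % Q + b))))) (sym e))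
               (codegree-pairs S∤u (x / Q) (y % Q) (x % Q)))
      where
      S∤u : S ∤ u
      S∤u (divides k refl) = ne (sym (trans (cong (_% S) (sym e)) ([m+kn]%n≡m%n (x / Q) k S)))

    codegree : ∀ x y → ∑ N (λ v → I x v * I y v) ≤ S * S + ⟦ near x y ⟧ * (Q * S)
    codegree x y with x / Q % S ≟ y / Q % S
    ... | yes e = ≤-trans (∑-mono N (λ v _ → ≤-trans (*-monoʳ-≤ (I x v) (⟦⟧≤1 _)) (≤-reflexive (*-identityʳ _))))
        (≤-trans (≤-reflexive (trans (degree x) (trans (sym (*-identityˡ _)) (cong (λ b → ⟦ b ⟧ * (Q * S)) (sym (≡ᵇ-true e))))))
                 (m≤n+m _ (S * S)))
    ... | no ne with ≤-total (x / Q) (y / Q)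
    ...   | inj₁ x≤y = ≤-trans (≤-reflexive (trans (∑-cong N (λ v _ → *-comm (I x v) (I y v))) (codegree-far x y x≤y ne))) (m≤m+n _ _)
    ...   | inj₂ y≤x = ≤-trans (≤-reflexive (codegree-far y x y≤x (λ e → ne (sym e)))) (m≤m+n _ _)

    hits : (ℕ → Bool) → ℕ → ℕ
    hits X v = card N (λ x → (label v x ≡ᵇ τ) ∧ X x)

    hits-∑ : ∀ X v → hits X v ≡ ∑ N (λ x → ⟦ X x ⟧ * I x v)
    hits-∑ X v = ∑-cong N (λ x _ → trans (⟦∧⟧ (label v x ≡ᵇ τ) (X x))
      (trans (*-comm (I v x) ⟦ X x ⟧) (cong (λ l → ⟦ X x ⟧ * ⟦ l ≡ᵇ τ ⟧) (label-sym v x))))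

    first-moment : ∀ X → ∑ N (hits X) ≡ card N X * (Q * S)
    first-moment X = begin
      ∑ N (hits X)                                   ≡⟨ ∑-cong N (λ v _ → hits-∑ X v) ⟩
      ∑ N (λ v → ∑ N (λ x → ⟦ X x ⟧ * I x v))        ≡⟨ ∑-swap N N (λ v x → ⟦ X x ⟧ * I x v) ⟩
      ∑ N (λ x → ∑ N (λ v → ⟦ X x ⟧ * I x v))        ≡⟨ ∑-cong N (λ x _ → trans (∑-*ˡ N ⟦ X x ⟧ (I x)) (cong (⟦ X x ⟧ *_) (degree x))) ⟩
      ∑ N (λ x → ⟦ X x ⟧ * (Q * S))                  ≡⟨ ∑-*ʳ N (Q * S) (λ x → ⟦ X x ⟧) ⟩
      card N X * (Q * S)                             ∎
      where open ≡-Reasoning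

    second-moment : ∀ X → ∑ N (λ v → hits X v * hits X v) ≤ card N X * (card N X * (S * S) + Q * L * (Q * S))
    second-moment X = begin
      ∑ N (λ v → hits X v * hits X v)
        ≡⟨ ∑-cong N (λ v _ → trans (cong₂ _*_ (hits-∑ X v) (hits-∑ X v)) (∑-* N (w v) (w v))) ⟩
      ∑ N (λ v → ∑ N (λ x → ∑ N (λ y → w v x * w v y)))
        ≡⟨ ∑-swap N N (λ v x → ∑ N (λ y → w v x * w v y)) ⟩
      ∑ N (λ x → ∑ N (λ v → ∑ N (λ y → w v x * w v y)))
        ≡⟨ ∑-cong N (λ x _ → ∑-swap N N (λ v y → w v x * w v y)) ⟩
      ∑ N (λ x → ∑ N (λ y → ∑ N (λ v → w v x * w v y)))
        ≡⟨ ∑-cong N (λ x _ → ∑-cong N (λ y _ → trans (∑-cong N (λ v _ → regroup ⟦ X x ⟧ (I x v) ⟦ X y ⟧ (I y v))) (∑-*ˡ N (⟦ X x ⟧ * ⟦ X y ⟧) (λ v → I x v * I y v)))) ⟩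
      ∑ N (λ x → ∑ N (λ y → ⟦ X x ⟧ * ⟦ X y ⟧ * ∑ N (λ v → I x v * I y v)))
        ≤⟨ ∑-mono N (λ x _ → ≤-trans (∑-mono N (λ y _ → pair x y)) (≤-reflexive (row x))) ⟩
      ∑ N (λ x → ⟦ X x ⟧ * (card N X * (S * S) + Q * L * (Q * S)))
        ≡⟨ ∑-*ʳ N _ (λ x → ⟦ X x ⟧) ⟩
      card N X * (card N X * (S * S) + Q * L * (Q * S)) ∎
      where
      open ≤-Reasoning
      w : ℕ → ℕ → ℕ
      w v x = ⟦ X x ⟧ * I x v
      regroup : ∀ a b c d → a * b * (c * d) ≡ a * c * (b * d)
      regroup = solve-∀
      expand : ∀ a b s c q → a * b * (s + c * q) ≡ a * (b * s + b * (c * q))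
      expand = solve-∀
      pair : ∀ x y → ⟦ X x ⟧ * ⟦ X y ⟧ * ∑ N (λ v → I x v * I y v) ≤ ⟦ X x ⟧ * (⟦ X y ⟧ * (S * S) + ⟦ near x y ⟧ * (Q * S))
      pair x y = begin
        ⟦ X x ⟧ * ⟦ X y ⟧ * ∑ N (λ v → I x v * I y v)                    ≤⟨ *-monoʳ-≤ (⟦ X x ⟧ * ⟦ X y ⟧) (codegree x y) ⟩
        ⟦ X x ⟧ * ⟦ X y ⟧ * (S * S + ⟦ near x y ⟧ * (Q * S))             ≡⟨ expand ⟦ X x ⟧ ⟦ X y ⟧ (S * S) ⟦ near x y ⟧ (Q * S) ⟩
        ⟦ X x ⟧ * (⟦ X y ⟧ * (S * S) + ⟦ X y ⟧ * (⟦ near x y ⟧ * (Q * S))) ≤⟨ *-monoʳ-≤ ⟦ X x ⟧ (+-monoʳ-≤ _ (*-monoˡ-≤ (⟦ near x y ⟧ * (Q * S)) (⟦⟧≤1 (X y)))) ⟩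
        ⟦ X x ⟧ * (⟦ X y ⟧ * (S * S) + 1 * (⟦ near x y ⟧ * (Q * S)))     ≡⟨ cong (λ z → ⟦ X x ⟧ * (⟦ X y ⟧ * (S * S) + z)) (*-identityˡ (⟦ near x y ⟧ * (Q * S))) ⟩
        ⟦ X x ⟧ * (⟦ X y ⟧ * (S * S) + ⟦ near x y ⟧ * (Q * S))           ∎
      row : ∀ x → ∑ N (λ y → ⟦ X x ⟧ * (⟦ X y ⟧ * (S * S) + ⟦ near x y ⟧ * (Q * S))) ≡ ⟦ X x ⟧ * (card N X * (S * S) + Q * L * (Q * S))
      row x = trans (∑-*ˡ N ⟦ X x ⟧ _) (cong (⟦ X x ⟧ *_) (trans (∑-+ N _ _)
        (cong₂ _+_ (∑-*ʳ N (S * S) (λ y → ⟦ X y ⟧))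
                   (trans (∑-*ʳ N (Q * S) (λ y → ⟦ near x y ⟧)) (cong (_* (Q * S)) (near-count x))))))

    deviation : (ℕ → Bool) → ℕ → ℕ
    deviation X v = ∣ L * hits X v - card N X ∣

    -- The main terms cancel because `L * S` is Q, and only the near pairs contribute. To avoid
    -- subtraction, the cross term is added to both sides.
    variance : ∀ X → ∑ N (λ v → deviation X v * deviation X v) ≤ card N X * (L * L * (Q * Q * Q))
    variance X = +-cancelʳ-≤ (2 * (N * (c * c))) _ _ (begin
      ∑ N (λ v → deviation X v * deviation X v) + 2 * (N * (c * c))
        ≡⟨ cong (∑ N (λ v → deviation X v * deviation X v) +_) (sym cross) ⟩
      ∑ N (λ v → deviation X v * deviation X v) + ∑ N (λ v → 2 * (L * hits X v * c))
        ≡⟨ sym (∑-+ N _ _) ⟩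
      ∑ N (λ v → deviation X v * deviation X v + 2 * (L * hits X v * c))
        ≡⟨ ∑-cong N (λ v _ → square-diff (L * hits X v) c) ⟩
      ∑ N (λ v → L * hits X v * (L * hits X v) + c * c)
        ≡⟨ trans (∑-+ N _ _) (cong₂ _+_ (trans (∑-cong N (λ v _ → regroup L (hits X v))) (∑-*ˡ N (L * L) _)) (∑-const N (c * c))) ⟩
      L * L * ∑ N (λ v → hits X v * hits X v) + N * (c * c)
        ≤⟨ +-monoˡ-≤ (N * (c * c)) (*-monoʳ-≤ (L * L) (second-moment X)) ⟩
      L * L * (c * (c * (S * S) + Q * L * (Q * S))) + N * (c * c)
        ≡⟨ final L S c ⟩
      c * (L * L * (Q * Q * Q)) + 2 * (N * (c * c)) ∎)
      where
      open ≤-Reasoning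
      c = card N X
      regroup : ∀ l h → l * h * (l * h) ≡ l * l * (h * h)
      regroup = solve-∀
      regroup₂ : ∀ l h c → 2 * (l * h * c) ≡ 2 * l * c * h
      regroup₂ = solve-∀
      regroup₃ : ∀ l s c → 2 * l * c * (c * (l * s * s)) ≡ 2 * (l * s * (l * s) * (c * c))
      regroup₃ = solve-∀
      cross : ∑ N (λ v → 2 * (L * hits X v * c)) ≡ 2 * (N * (c * c))
      cross = trans (∑-cong N (λ v _ → regroup₂ L (hits X v) c)) (trans (∑-*ˡ N (2 * L * c) (hits X))
        (trans (cong (2 * L * c *_) (first-moment X)) (regroup₃ L S c)))
      final : ∀ l s c → l * l * (c * (c * (s * s) + l * s * l * (l * s * s))) + l * s * (l * s) * (c * c)
                      ≡ c * (l * l * (l * s * (l * s) * (l * s))) + 2 * (l * s * (l * s) * (c * c))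
      final = solve-∀

    -- The size of X is replaced by N so that the bound is uniform in X.
    chebyshev : ∀ X θ → card N (λ v → θ <ᵇ deviation X v) * (θ * θ) ≤ N * (L * L * (Q * Q * Q))
    chebyshev X θ = begin
      card N (λ v → θ <ᵇ deviation X v) * (θ * θ)       ≡⟨ sym (∑-*ʳ N (θ * θ) _) ⟩
      ∑ N (λ v → ⟦ θ <ᵇ deviation X v ⟧ * (θ * θ))      ≤⟨ ∑-mono N (λ v _ → ⟦<ᵇ⟧-square (deviation X v)) ⟩
      ∑ N (λ v → deviation X v * deviation X v)         ≤⟨ variance X ⟩
      card N X * (L * L * (Q * Q * Q))                  ≤⟨ *-monoˡ-≤ (L * L * (Q * Q * Q)) (card≤ N X) ⟩
      N * (L * L * (Q * Q * Q))                         ∎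
      where
      open ≤-Reasoning
      ⟦<ᵇ⟧-square : ∀ d → ⟦ θ <ᵇ d ⟧ * (θ * θ) ≤ d * d
      ⟦<ᵇ⟧-square d with θ <ᵇ d in e
      ... | false = z≤n
      ... | true  = ≤-trans (≤-reflexive (*-identityˡ (θ * θ))) (*-mono-≤ θ≤d θ≤d)
        where
        θ≤d : θ ≤ d
        θ≤d = <⇒≤ (<ᵇ⇒< θ d (subst T (sym e) _))

-- Greedy embedding and sparse pairs

Subset : Set
Subset = ℕ → Bool

Edges : Set
Edges = ℕ → ℕ → Bool

infix 4 _⊑_
_⊑_ : Subset → Subset → Set
X ⊑ Y = ∀ {x} → X x ≡ true → Y x ≡ true

⟦⟧-mono : ∀ a b → (a ≡ true → b ≡ true) → ⟦ a ⟧ ≤ ⟦ b ⟧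
⟦⟧-mono false b imp = z≤n
⟦⟧-mono true  b imp rewrite imp refl = ≤-refl

⟦⟧-<1 : ∀ b → ⟦ b ⟧ < 1 → b ≡ false
⟦⟧-<1 false _ = refl
⟦⟧-<1 true (s≤s ())

<ᵇ-false⁻ : ∀ {m n} → (m <ᵇ n) ≡ false → n ≤ m
<ᵇ-false⁻ {m} {n} e = ≮⇒≥ (λ lt → subst T e (<⇒<ᵇ lt))

<ᵇ-true⁻ : ∀ {m n} → (m <ᵇ n) ≡ true → m < n
<ᵇ-true⁻ {m} {n} e = <ᵇ⇒< m n (subst T (sym e) _)

module Graphs (N : ℕ) where

  ∣_∣ˢ : Subset → ℕ
  ∣ X ∣ˢ = card N X

  card-mono : ∀ {X Y} → X ⊑ Y → ∣ X ∣ˢ ≤ ∣ Y ∣ˢ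
  card-mono {X} {Y} X⊑Y = ∑-mono N (λ x _ → ⟦⟧-mono (X x) (Y x) X⊑Y)

  deg : Edges → ℕ → Subset → ℕ
  deg E v X = ∣ (λ x → E v x ∧ X x) ∣ˢ

  deg-mono : ∀ {E E′ : Edges} {X X′ v} → (∀ {x} → E v x ∧ X x ≡ true → E′ v x ∧ X′ x ≡ true) → deg E v X ≤ deg E′ v X′
  deg-mono = card-mono

  double-count : ∀ E → (∀ x y → E x y ≡ E y x) → ∀ X Y →
    ∑ N (λ x → ⟦ X x ⟧ * deg E x Y) ≡ ∑ N (λ y → ⟦ Y y ⟧ * deg E y X)
  double-count E E-sym X Y = begin
    ∑ N (λ x → ⟦ X x ⟧ * deg E x Y)                       ≡⟨ ∑-cong N (λ x _ → sym (∑-*ˡ N ⟦ X x ⟧ _)) ⟩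
    ∑ N (λ x → ∑ N (λ y → ⟦ X x ⟧ * ⟦ E x y ∧ Y y ⟧))     ≡⟨ ∑-swap N N _ ⟩
    ∑ N (λ y → ∑ N (λ x → ⟦ X x ⟧ * ⟦ E x y ∧ Y y ⟧))     ≡⟨ ∑-cong N (λ y _ → trans (∑-cong N (λ x _ → flip x y)) (∑-*ˡ N ⟦ Y y ⟧ _)) ⟩
    ∑ N (λ y → ⟦ Y y ⟧ * deg E y X)                       ∎
    where
    open ≡-Reasoning
    swap : ∀ a b c → a * (b * c) ≡ c * (b * a)
    swap = solve-∀
    flip : ∀ x y → ⟦ X x ⟧ * ⟦ E x y ∧ Y y ⟧ ≡ ⟦ Y y ⟧ * ⟦ E y x ∧ X x ⟧
    flip x y rewrite ⟦∧⟧ (E x y) (Y y) | ⟦∧⟧ (E y x) (X x) | E-sym x y = swap ⟦ X x ⟧ ⟦ E y x ⟧ ⟦ Y y ⟧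

  -- The pattern is a complete graph on n vertices with digits `h i j` for i < j. Injectivity of the
  -- map will come from the edge relations, which exclude loops.
  Copy : ℕ → (ℕ → Edges) → (ℕ → ℕ → ℕ) → (ℕ → Subset) → Set
  Copy n E h U = Σ (ℕ → ℕ) λ f →
    (∀ i → i < n → f i < N × U i (f i) ≡ true) ×
    (∀ i j → i < j → j < n → E (h i j) (f i) (f j) ≡ true)

  extend : ∀ {n E h U U′ v} → v < N → U 0 v ≡ true →
    (∀ i → i < n → ∀ {x} → U′ i x ≡ true → E (h 0 (suc i)) v x ≡ true × U (suc i) x ≡ true) →
    Copy n E (λ i j → h (suc i) (suc j)) U′ → Copy (suc n) E h U
  extend {n} {E} {h} {U} {U′} {v} v<N Uv sub (f , f∈U , f-edge) = g , g∈U , g-edge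
    where
    g : ℕ → ℕ
    g zero    = v
    g (suc i) = f i
    g∈U : ∀ i → i < suc n → g i < N × U i (g i) ≡ true
    g∈U zero    _         = v<N , Uv
    g∈U (suc i) (s≤s i<n) = proj₁ (f∈U i i<n) , proj₂ (sub i i<n (proj₂ (f∈U i i<n)))
    g-edge : ∀ i j → i < j → j < suc n → E (h i j) (g i) (g j) ≡ true
    g-edge zero    (suc j) _         (s≤s j<n) = proj₁ (sub j j<n (proj₂ (f∈U j j<n)))
    g-edge (suc i) (suc j) (s≤s i<j) (s≤s j<n) = f-edge i j i<j j<n

  SparsePair : (ℕ → Edges) → (ℕ → ℕ → ℕ) → ℕ → ℕ → Subset → Set
  SparsePair E h t w X = Σ Subset λ A → Σ Subset λ B → ∃[ i ] ∃[ j ]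
    A ⊑ X × B ⊑ X × w ≤ ∣ A ∣ˢ × w ≤ ∣ B ∣ˢ ×
    (∀ x → A x ≡ true → t * deg (E (h i j)) x B < ∣ B ∣ˢ)

  -- Each embedded vertex shrinks the later candidate sets by a factor of at most t, hence
  -- `t ^ n * w`. If no vertex of `U 0` is good, each fails towards some later set; as there are
  -- fewer than t of these, one of them is failed by more than w vertices, and these form A.
  greedy : ∀ n E h U X t w → 1 ≤ w → n ≤ t → (∀ i → U i ⊑ X) → (∀ i → i < n → t ^ n * w ≤ ∣ U i ∣ˢ) →
    Copy n E h U ⊎ SparsePair E h t w X
  greedy zero    E h U X t w 1≤w n≤t U⊑X big = inj₁ ((λ _ → 0) , (λ _ ()) , (λ _ _ _ ()))
  greedy (suc m) E h U X t@(suc _) w 1≤w n≤t U⊑X big =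
    -- If the average number of failures over `U 0` is below 1, some vertex has none; otherwise
    -- there are at least as many failures as vertices.
    helper (∑ N (λ v → ⟦ U 0 v ⟧ * fails v) <? ∑ N (λ v → ⟦ U 0 v ⟧ * 1))
    where
    V : ℕ → Subset
    V j = U (suc j)
    fail : ℕ → ℕ → Bool
    fail v j = t * deg (E (h 0 (suc j))) v (V j) <ᵇ ∣ V j ∣ˢ
    fails : ℕ → ℕ
    fails v = ∑ m (λ j → ⟦ fail v j ⟧)
    A : ℕ → Subset
    A j v = U 0 v ∧ fail v j
    1≤t^m : 1 ≤ t ^ m
    1≤t^m = m^n>0 t m
    w≤ : w ≤ t ^ suc m * w
    w≤ = ≤-trans (≤-reflexive (sym (*-identityˡ w))) (*-monoˡ-≤ w (m^n>0 t (suc m)))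
    m*w< : m * w < ∣ U 0 ∣ˢ
    m*w< = begin-strict
      m * w              <⟨ m<n+m (m * w) 1≤w ⟩
      suc m * w          ≤⟨ *-monoˡ-≤ w n≤t ⟩
      t * w              ≤⟨ *-monoˡ-≤ w (≤-trans (≤-reflexive (sym (*-identityʳ t))) (*-monoʳ-≤ t 1≤t^m)) ⟩
      t ^ suc m * w      ≤⟨ big 0 (s≤s z≤n) ⟩
      ∣ U 0 ∣ˢ           ∎
      where open ≤-Reasoning
    helper : Dec (∑ N (λ v → ⟦ U 0 v ⟧ * fails v) < ∑ N (λ v → ⟦ U 0 v ⟧ * 1)) → Copy (suc m) E h U ⊎ SparsePair E h t w X
    helper (yes lt) with ∑-find N _ _ lt
    ... | v , v<N , lt′ with ⟦⟧-<⇒ (U 0 v) lt′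
    ...   | Uv , none with greedy m E (λ i j → h (suc i) (suc j)) (λ j x → E (h 0 (suc j)) v x ∧ V j x) X t w 1≤w
                              (≤-trans (n≤1+n m) n≤t) (λ i e → U⊑X (suc i) (proj₂ (∧-true⁻ e))) big′
      where
      big′ : ∀ j → j < m → t ^ m * w ≤ deg (E (h 0 (suc j))) v (V j)
      big′ j j<m = *-cancelˡ-≤ t (begin
        t * (t ^ m * w)                  ≡⟨ sym (*-assoc t (t ^ m) w) ⟩
        t ^ suc m * w                    ≤⟨ big (suc j) (s≤s j<m) ⟩
        ∣ V j ∣ˢ                         ≤⟨ <ᵇ-false⁻ (⟦⟧-<1 (fail v j) (≤-<-trans (term≤∑ m (λ j → ⟦ fail v j ⟧) j<m) none)) ⟩
        t * deg (E (h 0 (suc j))) v (V j) ∎)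
        where open ≤-Reasoning
    ...     | inj₁ c = inj₁ (extend {E = E} {h} {U} v<N Uv (λ _ _ → ∧-true⁻) c)
    ...     | inj₂ (A , B , i , j , p) = inj₂ (A , B , suc i , suc j , p)
    helper (no ¬lt) with ∑-find m (λ _ → w) (λ j → ∣ A j ∣ˢ) (begin-strict
        ∑ m (λ _ → w)                              ≡⟨ ∑-const m w ⟩
        m * w                                      <⟨ m*w< ⟩
        ∣ U 0 ∣ˢ                                   ≡⟨ ∑-cong N (λ v _ → sym (*-identityʳ _)) ⟩
        ∑ N (λ v → ⟦ U 0 v ⟧ * 1)                  ≤⟨ ≮⇒≥ ¬lt ⟩
        ∑ N (λ v → ⟦ U 0 v ⟧ * fails v)            ≡⟨ ∑-cong N (λ v _ → trans (sym (∑-*ˡ m ⟦ U 0 v ⟧ _)) (∑-cong m (λ j _ → sym (⟦∧⟧ (U 0 v) (fail v j))))) ⟩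
        ∑ N (λ v → ∑ m (λ j → ⟦ A j v ⟧))          ≡⟨ ∑-swap N m (λ v j → ⟦ A j v ⟧) ⟩
        ∑ m (λ j → ∣ A j ∣ˢ)                       ∎)
      where open ≤-Reasoning
    ... | j , j<m , w<Aj = inj₂ (A j , V j , 0 , suc j , (λ e → U⊑X 0 (proj₁ (∧-true⁻ e))) , U⊑X (suc j) , <⇒≤ w<Aj ,
            ≤-trans w≤ (big (suc j) (s≤s j<m)) , (λ x e → <ᵇ-true⁻ (proj₂ (∧-true⁻ {U 0 x} e))))

  -- Markov's inequality: few vertices of B have a large degree into some A i.
  clean : ∀ E → (∀ x y → E x y ≡ E y x) → ∀ k K t B (A : ℕ → Subset) → k ≤ K → 1 ≤ K →
    (∀ i → i < k → 1 ≤ ∣ A i ∣ˢ) →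
    (∀ i → i < k → ∀ a → A i a ≡ true → 2 * K * t * deg E a B ≤ ∣ B ∣ˢ) →
    Σ Subset λ B′ → B′ ⊑ B × ∣ B ∣ˢ ≤ 2 * ∣ B′ ∣ˢ ×
      (∀ i → i < k → ∀ b → B′ b ≡ true → t * deg E b (A i) ≤ ∣ A i ∣ˢ)
  clean E E-sym k K@(suc _) t B A k≤K _ A≠∅ sparse = B′ , (λ e → proj₁ (∧-true⁻ e)) , half , small
    where
    open ≤-Reasoning
    bad : ℕ → ℕ → Bool
    bad b i = ∣ A i ∣ˢ <ᵇ t * deg E b (A i)
    bads : ℕ → ℕ
    bads b = ∑ k (λ i → ⟦ bad b i ⟧)
    B′ : Subset
    B′ b = B b ∧ (bads b ≡ᵇ 0)
    small : ∀ i → i < k → ∀ b → B′ b ≡ true → t * deg E b (A i) ≤ ∣ A i ∣ˢ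
    small i i<k b e = <ᵇ-false⁻ (⟦⟧-<1 (bad b i) (s≤s (≤-trans (term≤∑ k (λ i → ⟦ bad b i ⟧) i<k) (≤-reflexive (≡ᵇ-true⁻ (proj₂ (∧-true⁻ {B b} e)))))))
    Bad : ℕ → ℕ
    Bad i = ∑ N (λ b → ⟦ B b ⟧ * ⟦ bad b i ⟧)
    bad-≤ : ∀ b i → ⟦ bad b i ⟧ * ∣ A i ∣ˢ ≤ t * deg E b (A i)
    bad-≤ b i with bad b i in e
    ... | false = z≤n
    ... | true  = ≤-trans (≤-reflexive (*-identityˡ _)) (<⇒≤ (<ᵇ-true⁻ {∣ A i ∣ˢ} e))
    sparse′ : ∀ i → i < k → ∀ a → ⟦ A i a ⟧ * (2 * K * t * deg E a B) ≤ ⟦ A i a ⟧ * ∣ B ∣ˢ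
    sparse′ i i<k a with A i a in e
    ... | false = z≤n
    ... | true  = *-monoʳ-≤ 1 (sparse i i<k a e)
    swap₁ : ∀ a b c → a * (b * c) ≡ b * (a * c)
    swap₁ = solve-∀
    -- Each of the at most K sets spoils at most a fraction 1 / (2 K) of B, so half of B survives.
    Bad-≤ : ∀ i → i < k → 2 * K * Bad i ≤ ∣ B ∣ˢ
    Bad-≤ i i<k = *-cancelʳ-≤ _ _ ∣ A i ∣ˢ {{>-nonZero (A≠∅ i i<k)}} (begin
      2 * K * Bad i * ∣ A i ∣ˢ                                    ≡⟨ *-assoc (2 * K) (Bad i) _ ⟩
      2 * K * (Bad i * ∣ A i ∣ˢ)                                  ≡⟨ cong (2 * K *_) (sym (∑-*ʳ N ∣ A i ∣ˢ _)) ⟩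
      2 * K * ∑ N (λ b → ⟦ B b ⟧ * ⟦ bad b i ⟧ * ∣ A i ∣ˢ)        ≤⟨ *-monoʳ-≤ (2 * K) (∑-mono N (λ b _ → ≤-trans (≤-reflexive (*-assoc ⟦ B b ⟧ _ _)) (≤-trans (*-monoʳ-≤ ⟦ B b ⟧ (bad-≤ b i)) (≤-reflexive (swap₁ ⟦ B b ⟧ t _))))) ⟩
      2 * K * ∑ N (λ b → t * (⟦ B b ⟧ * deg E b (A i)))           ≡⟨ cong (2 * K *_) (∑-*ˡ N t _) ⟩
      2 * K * (t * ∑ N (λ b → ⟦ B b ⟧ * deg E b (A i)))           ≡⟨ cong (λ z → 2 * K * (t * z)) (double-count E E-sym B (A i)) ⟩
      2 * K * (t * ∑ N (λ a → ⟦ A i a ⟧ * deg E a B))             ≡⟨ sym (*-assoc (2 * K) t _) ⟩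
      2 * K * t * ∑ N (λ a → ⟦ A i a ⟧ * deg E a B)               ≡⟨ sym (∑-*ˡ N (2 * K * t) _) ⟩
      ∑ N (λ a → 2 * K * t * (⟦ A i a ⟧ * deg E a B))             ≤⟨ ∑-mono N (λ a _ → ≤-trans (≤-reflexive (swap₁ (2 * K * t) ⟦ A i a ⟧ _)) (sparse′ i i<k a)) ⟩
      ∑ N (λ a → ⟦ A i a ⟧ * ∣ B ∣ˢ)                              ≡⟨ ∑-*ʳ N ∣ B ∣ˢ _ ⟩
      ∣ A i ∣ˢ * ∣ B ∣ˢ                                           ≡⟨ *-comm ∣ A i ∣ˢ ∣ B ∣ˢ ⟩
      ∣ B ∣ˢ * ∣ A i ∣ˢ                                           ∎)
    few : 2 * ∑ k Bad ≤ ∣ B ∣ˢ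
    few = *-cancelˡ-≤ K (begin
      K * (2 * ∑ k Bad)              ≡⟨ sym (*-assoc K 2 (∑ k Bad)) ⟩
      K * 2 * ∑ k Bad                ≡⟨ cong (_* ∑ k Bad) (*-comm K 2) ⟩
      2 * K * ∑ k Bad                ≡⟨ sym (∑-*ˡ k (2 * K) Bad) ⟩
      ∑ k (λ i → 2 * K * Bad i)      ≤⟨ ∑-≤ k ∣ B ∣ˢ Bad-≤ ⟩
      k * ∣ B ∣ˢ                     ≤⟨ *-monoˡ-≤ ∣ B ∣ˢ k≤K ⟩
      K * ∣ B ∣ˢ                     ∎)
    pointwise : ∀ b → ⟦ B b ⟧ ≤ ⟦ B′ b ⟧ + ⟦ B b ⟧ * bads b
    pointwise b with B b | bads b
    ... | false | _     = z≤n
    ... | true  | zero  = s≤s z≤n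
    ... | true  | suc _ = s≤s z≤n
    cover : ∣ B ∣ˢ ≤ ∣ B′ ∣ˢ + ∑ k Bad
    cover = begin
      ∣ B ∣ˢ                                             ≤⟨ ∑-mono N (λ b _ → pointwise b) ⟩
      ∑ N (λ b → ⟦ B′ b ⟧ + ⟦ B b ⟧ * bads b)            ≡⟨ ∑-+ N _ _ ⟩
      ∣ B′ ∣ˢ + ∑ N (λ b → ⟦ B b ⟧ * bads b)             ≡⟨ cong (∣ B′ ∣ˢ +_) (trans (∑-cong N (λ b _ → sym (∑-*ˡ k ⟦ B b ⟧ _))) (∑-swap N k (λ b i → ⟦ B b ⟧ * ⟦ bad b i ⟧))) ⟩
      ∣ B′ ∣ˢ + ∑ k Bad                                  ∎
    half : ∣ B ∣ˢ ≤ 2 * ∣ B′ ∣ˢ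
    half = +-cancelʳ-≤ ∣ B ∣ˢ _ _ (begin
      ∣ B ∣ˢ + ∣ B ∣ˢ                ≡⟨ cong (∣ B ∣ˢ +_) (sym (+-identityʳ ∣ B ∣ˢ)) ⟩
      2 * ∣ B ∣ˢ                     ≤⟨ *-monoʳ-≤ 2 cover ⟩
      2 * (∣ B′ ∣ˢ + ∑ k Bad)        ≡⟨ *-distribˡ-+ 2 ∣ B′ ∣ˢ (∑ k Bad) ⟩
      2 * ∣ B′ ∣ˢ + 2 * ∑ k Bad      ≤⟨ +-monoʳ-≤ (2 * ∣ B′ ∣ˢ) few ⟩
      2 * ∣ B′ ∣ˢ + ∣ B ∣ˢ           ∎)

-- Recursive construction of pairwise red-sparse sets

module Tree
  (N B : ℕ) .{{_ : NonZero B}} (label : ℕ → ℕ → ℕ) (label-sym : ∀ x y → label x y ≡ label y x)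
  (R : Edges) (R-sym : ∀ x y → R x y ≡ R y x)
  (n : ℕ) (h : ℕ → ℕ → ℕ) (h<B : ∀ i j → h i j < B)
  (K t : ℕ) (n≤K : n ≤ K) (1≤K : 1 ≤ K) (1≤t : 1 ≤ t)
  where

  open Graphs N

  -- Labels are strings of digits in base B, and prefix ρ drops the last ρ digits.
  prefix : ℕ → ℕ → ℕ
  prefix ρ l = _/_ l (B ^ ρ) {{m^n≢0 B ρ}}

  E : ℕ → ℕ → Edges
  E ρ P x y = R x y ∧ (prefix ρ (label x y) ≡ᵇ P)

  E-sym : ∀ ρ P x y → E ρ P x y ≡ E ρ P y x
  E-sym ρ P x y rewrite R-sym x y | label-sym x y = refl

  prefix-suc : ∀ {ρ P s l} → s < B → prefix ρ l ≡ P * B + s → prefix (suc ρ) l ≡ P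
  prefix-suc {ρ} {P} {s} {l} s<B e = begin
    l / (B * B ^ ρ)      ≡⟨ /-congʳ (*-comm B (B ^ ρ)) ⟩
    l / (B ^ ρ * B)      ≡⟨ sym (m/n/o≡m/[n*o] l (B ^ ρ) B) ⟩
    l / B ^ ρ / B        ≡⟨ cong (_/ B) e ⟩
    (P * B + s) / B      ≡⟨ +-distrib-/-∣ˡ {P * B} s {B} (divides-refl P) ⟩
    P * B / B + s / B    ≡⟨ cong₂ _+_ (m*n/n≡m P B) (m<n⇒m/n≡0 s<B) ⟩
    P + 0                ≡⟨ +-identityʳ P ⟩
    P                    ∎
    where
    open ≡-Reasoning
    instance
      _ = m^n≢0 B ρ
      _ = m^n≢0 B (suc ρ)
      _ = m*n≢0 (B ^ ρ) B

  -- A prefix P with ρ digits dropped stands for the labels from `P * B ^ ρ` up to, but excluding,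
  -- `suc P * B ^ ρ`. `coarsen` is inclusion of such intervals; `bound` compares their right ends
  -- and will keep the blue labels below L.
  record Refines (ρ′ P′ ρ P : ℕ) : Set where
    constructor mk
    field
      coarsen : ∀ l → prefix ρ′ l ≡ P′ → prefix ρ l ≡ P
      bound   : suc P′ * B ^ ρ′ ≤ suc P * B ^ ρ

  Refines-refl : ∀ {ρ P} → Refines ρ P ρ P
  Refines-refl = mk (λ _ e → e) ≤-refl

  Refines-trans : ∀ {ρ″ P″ ρ′ P′ ρ P} → Refines ρ″ P″ ρ′ P′ → Refines ρ′ P′ ρ P → Refines ρ″ P″ ρ P
  Refines-trans (mk f a) (mk g b) = mk (λ l e → g l (f l e)) (≤-trans a b)

  Refines-suc : ∀ {ρ P s} → s < B → Refines ρ (P * B + s) (suc ρ) P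
  Refines-suc {ρ} {P} {s} s<B = mk (λ l → prefix-suc {ρ} s<B) (begin
    suc (P * B + s) * B ^ ρ   ≡⟨ cong (_* B ^ ρ) (sym (+-suc (P * B) s)) ⟩
    (P * B + suc s) * B ^ ρ   ≤⟨ *-monoˡ-≤ (B ^ ρ) (+-monoʳ-≤ (P * B) s<B) ⟩
    (P * B + B) * B ^ ρ       ≡⟨ cong (_* B ^ ρ) (+-comm (P * B) B) ⟩
    suc P * B * B ^ ρ         ≡⟨ *-assoc (suc P) B (B ^ ρ) ⟩
    suc P * (B * B ^ ρ)       ∎)
    where open ≤-Reasoning

  E-mono : ∀ {ρ′ P′ ρ P} → Refines ρ′ P′ ρ P → ∀ {x y} → E ρ′ P′ x y ≡ true → E ρ P x y ≡ true
  E-mono (mk r _) {x} {y} e = let (a , b) = ∧-true⁻ {R x y} e in ∧-true⁺ a (≡ᵇ-true (r _ (≡ᵇ-true⁻ b)))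

  deg-refine : ∀ {ρ′ P′ ρ P} → Refines ρ′ P′ ρ P → ∀ x Y → deg (E ρ′ P′) x Y ≤ deg (E ρ P) x Y
  deg-refine {ρ′} {P′} {ρ} {P} r x Y = deg-mono {E ρ′ P′} {E ρ P} {Y} {Y} {x}
    (λ {y} e → let (a , b) = ∧-true⁻ {E ρ′ P′ x y} e in ∧-true⁺ (E-mono r a) b)

  -- Every internal node of the tree consumes one digit.
  depth : ℕ → ℕ → ℕ
  depth zero    ρ = ρ
  depth (suc d) ρ = suc (depth d (depth d ρ))

  T₀ : ℕ
  T₀ = 2 * K * t

  -- The size of X required for depth d: `T₀ ^ n` pays for the greedy embedding, and 2 for the half
  -- lost in `clean`.
  cost : ℕ → ℕ → ℕ
  cost zero    w = w
  cost (suc d) w = T₀ ^ n * (2 * cost d w)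

  Found : Set
  Found = ∃[ ρ ] ∃[ P ] Copy n (λ s → E ρ (P * B + s)) h (λ _ _ → true)

  record SparseFamily (d ρ P : ℕ) (X : Subset) (w : ℕ) : Set where
    field
      sets    : ℕ → Subset
      P′      : ℕ
      refines : Refines ρ P′ (depth d ρ) P
      inside  : ∀ i → i < 2 ^ d → sets i ⊑ X
      large   : ∀ i → i < 2 ^ d → w ≤ ∣ sets i ∣ˢ
      sparse  : ∀ i j → i < j → j < 2 ^ d → ∀ x → sets i x ≡ true → t * deg (E ρ P′) x (sets j) ≤ ∣ sets j ∣ˢ

  open SparseFamily

  1≤T₀ : 1 ≤ T₀
  1≤T₀ = *-mono-≤ {1} {2 * K} (≤-trans 1≤K (m≤m+n K _)) 1≤t

  n≤T₀ : n ≤ T₀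
  n≤T₀ = ≤-trans n≤K (≤-trans (m≤m+n K _) (≤-trans (≤-reflexive (sym (*-identityʳ (2 * K)))) (*-monoʳ-≤ (2 * K) 1≤t)))

  1≤cost : ∀ d {w} → 1 ≤ w → 1 ≤ cost d w
  1≤cost zero    1≤w = 1≤w
  1≤cost (suc d) 1≤w = *-mono-≤ {1} {T₀ ^ n} (m^n>0 T₀ {{>-nonZero 1≤T₀}} n) (*-mono-≤ {1} {2} (s≤s z≤n) (1≤cost d 1≤w))

  concat : ℕ → (ℕ → Subset) → (ℕ → Subset) → ℕ → Subset
  concat k U V i = if i <ᵇ k then U i else V (i ∸ k)

  concat-elim : ∀ k U V (C : ℕ → Subset → Set) → (∀ i → i < k → C i (U i)) → (∀ i → C (k + i) (V i)) → ∀ i → C i (concat k U V i)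
  concat-elim k U V C u v i with i <ᵇ k in e
  ... | true  = u i (<ᵇ-true⁻ e)
  ... | false = subst (λ z → C z (V (i ∸ k))) (m+[n∸m]≡n {k} {i} (<ᵇ-false⁻ {i} {k} e)) (v (i ∸ k))

  2^suc-< : ∀ d {j} → 2 ^ d + j < 2 ^ suc d → j < 2 ^ d
  2^suc-< d {j} lt = +-cancelˡ-< (2 ^ d) _ _ (<-≤-trans lt (≤-reflexive (cong (2 ^ d +_) (+-identityʳ (2 ^ d)))))

  -- A bound on the degrees from A into D passes to subsets of A, but not to subsets of D. So the
  -- family in A is completed before D is entered; `clean` then turns the bound around, into one on
  -- the degrees from `D′` into each finished set, and this passes to the family chosen inside `D′`.
  -- Extending the prefix only removes red edges, so earlier bounds survive. The factor `2 * K` by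
  -- which `T₀` exceeds t pays for the turn.
  tree : ∀ d ρ P X w → 2 ^ d ≤ K → 1 ≤ w → cost d w ≤ ∣ X ∣ˢ → Found ⊎ SparseFamily d ρ P X w
  tree zero ρ P X w _ 1≤w big = inj₂ (record
    { sets    = λ _ → X
    ; P′      = P
    ; refines = Refines-refl
    ; inside  = λ _ _ e → e
    ; large   = λ _ _ → big
    ; sparse  = λ { i zero () _ ; i (suc j) _ (s≤s ()) }
    })
  tree (suc d) ρ P X w 2^≤K 1≤w big
    with greedy n (λ s → E (depth d (depth d ρ)) (P * B + s)) h (λ _ → X) X T₀ (2 * cost d w)
           (*-mono-≤ {1} {2} (s≤s z≤n) (1≤cost d 1≤w)) n≤T₀ (λ _ e → e) (λ _ _ → big)
  ... | inj₁ (f , f∈ , f-edge) = inj₁ (depth d (depth d ρ) , P , f , (λ i p → proj₁ (f∈ i p) , refl) , f-edge)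
  ... | inj₂ (A , D , a , b , A⊑X , D⊑X , A-big , D-big , sp)
    with tree d (depth d ρ) (P * B + h a b) A w (≤-trans (m≤m+n (2 ^ d) _) 2^≤K) 1≤w (≤-trans (m≤m+n (cost d w) _) A-big)
  ... | inj₁ found = inj₁ found
  ... | inj₂ FA
    with clean (E (depth d (depth d ρ)) (P * B + h a b)) (E-sym (depth d (depth d ρ)) (P * B + h a b)) (2 ^ d) K t D (sets FA)
           (≤-trans (m≤m+n (2 ^ d) _) 2^≤K) 1≤K (λ i p → ≤-trans 1≤w (large FA i p)) (λ i p x e → <⇒≤ (sp x (inside FA i p e)))
  ... | D′ , D′⊑D , half , small
    with tree d ρ (P′ FA) D′ w (≤-trans (m≤m+n (2 ^ d) _) 2^≤K) 1≤w (*-cancelˡ-≤ 2 (≤-trans D-big half))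
  ... | inj₁ found = inj₁ found
  ... | inj₂ FD = inj₂ (record
    { sets    = U
    ; P′      = P′ FD
    ; refines = Refines-trans (refines FD) (Refines-trans (refines FA) (Refines-suc (h<B a b)))
    ; inside  = concat-elim k (sets FD) (sets FA) (λ i Y → i < 2 ^ suc d → Y ⊑ X)
                  (λ i i<k _ e → D⊑X (D′⊑D (inside FD i i<k e)))
                  (λ i lt e → A⊑X (inside FA i (2^suc-< d lt) e))
    ; large   = concat-elim k (sets FD) (sets FA) (λ i Y → i < 2 ^ suc d → w ≤ ∣ Y ∣ˢ)
                  (λ i i<k _ → large FD i i<k)
                  (λ i lt → large FA i (2^suc-< d lt))
    ; sparse  = λ i j → concat-elim k (sets FD) (sets FA)
        (λ i Y → i < j → j < 2 ^ suc d → ∀ x → Y x ≡ true → t * deg E′ x (U j) ≤ ∣ U j ∣ˢ)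
        (λ i i<k → concat-elim k (sets FD) (sets FA)
          (λ j Z → i < j → j < 2 ^ suc d → ∀ x → sets FD i x ≡ true → t * deg E′ x Z ≤ ∣ Z ∣ˢ)
          (λ j j<k i<j _ → sparse FD i j i<j j<k)
          (λ j _ lt x e → ≤-trans (*-monoʳ-≤ t (deg-refine (Refines-trans (refines FD) (refines FA)) x (sets FA j)))
                                  (small j (2^suc-< d lt) x (inside FD i i<k e)))
          j)
        (λ i → concat-elim k (sets FD) (sets FA)
          (λ j Z → k + i < j → j < 2 ^ suc d → ∀ x → sets FA i x ≡ true → t * deg E′ x Z ≤ ∣ Z ∣ˢ)
          (λ j j<k lt → contradiction (<-trans (≤-<-trans (m≤m+n k i) lt) j<k) (<-irrefl refl))
          (λ j lt lt′ x e → ≤-trans (*-monoʳ-≤ t (deg-refine (refines FD) x (sets FA j)))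
                                    (sparse FA i j (+-cancelˡ-< k _ _ lt) (2^suc-< d lt′) x e))
          j)
        i
    })
    where
    k = 2 ^ d
    -- The sets in D come first: `small` bounds degrees from them into the sets in A, and `sparse`
    -- speaks only of degrees into later sets.
    U : ℕ → Subset
    U = concat k (sets FD) (sets FA)
    E′ : Edges
    E′ = E ρ (P′ FD)

-- Embedding while avoiding a sparse graph

≤-∣-∣ : ∀ a b {θ} → ∣ a - b ∣ ≤ θ → a ≤ b + θ
≤-∣-∣ a b le = ≤-trans (m≤n+∣m-n∣ a b) (+-monoʳ-≤ b le)

-- The pointwise form of `hits≤`: a neighbour of v with the desired label is kept, or is red (`r`),
-- or is v itself (`q`), or is deleted for one of its `b` irregular red neighbourhoods.
⟦∧⟧-cover : ∀ l w r q b f → (l ≡ true → r ≡ false → q ≡ false → f ≡ true) →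
  ⟦ l ∧ w ⟧ ≤ ⟦ (f ∧ w) ∧ (b ≡ᵇ 0) ⟧ + ⟦ r ∧ w ⟧ + (⟦ q ⟧ + ⟦ w ⟧ * b)
⟦∧⟧-cover false w     r     q     b       f imp = z≤n
⟦∧⟧-cover true  false r     q     b       f imp = z≤n
⟦∧⟧-cover true  true  true  q     b       f imp = ≤-trans (m≤n+m 1 ⟦ (f ∧ true) ∧ (b ≡ᵇ 0) ⟧) (m≤m+n _ (⟦ q ⟧ + 1 * b))
⟦∧⟧-cover true  true  false true  b       f imp = ≤-trans (s≤s z≤n) (m≤n+m (suc (b + 0)) (⟦ (f ∧ true) ∧ (b ≡ᵇ 0) ⟧ + 0))
⟦∧⟧-cover true  true  false false (suc b) f imp = ≤-trans (s≤s z≤n) (m≤n+m (suc (b + 0)) (⟦ (f ∧ true) ∧ false ⟧ + 0))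
⟦∧⟧-cover true  true  false false zero    f imp rewrite imp refl refl refl = s≤s z≤n

module Avoiding
  (N L : ℕ) .{{_ : NonZero L}} (label : ℕ → ℕ → ℕ)
  (θ β F Y n : ℕ)
  where

  open Graphs N

  labelled : ℕ → Edges
  labelled τ x y = label x y ≡ᵇ τ

  irregular : ℕ → Subset → ℕ → Bool
  irregular τ X v = θ <ᵇ ∣ L * deg (labelled τ) v X - ∣ X ∣ˢ ∣

  -- With m vertices left to embed, vertices have at most |Y| / scale m red neighbours in a later set Y;
  -- each embedding step worsens this ratio by a factor of at most 4.
  scale : ℕ → ℕ
  scale m = 8 * L * 4 ^ m

  module _
    (regular : ∀ {τ} → τ < L → ∀ X → ∣ irregular τ X ∣ˢ ≤ β)
    (exceptional : n * (F * β) + n * (n * (N * β)) < F * Y)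
    (θ-small : θ * scale n ≤ Y)
    (F-small : 8 * L * F ≤ Y)
    (B : ℕ) (colour : ℕ → ℕ) (colour<L : ∀ {s} → s < B → colour s < L)
    (R : Edges) (E : ℕ → Edges)
    (E-label : ∀ {s x y} → E s x y ≡ true → label x y ≡ colour s)
    (E-cover : ∀ {s x y} → s < B → label x y ≡ colour s → R x y ≡ false → x ≢ y → E s x y ≡ true)
    where

    8L≤scale : ∀ m → 8 * L ≤ scale m
    8L≤scale m = ≤-trans (≤-reflexive (sym (*-identityʳ (8 * L)))) (*-monoʳ-≤ (8 * L) (m^n>0 4 m))

    scale-mono : ∀ {m k} → m ≤ k → scale m ≤ scale k
    scale-mono m≤k = *-monoʳ-≤ (8 * L) (^-monoʳ-≤ 4 m≤k)

    Y≤Y*pow : ∀ m → Y ≤ Y * (2 * L) ^ m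
    Y≤Y*pow m = ≤-trans (≤-reflexive (sym (*-identityʳ Y))) (*-monoʳ-≤ Y (m^n>0 (2 * L) {{m*n≢0 2 L}} m))

    -- The vertex v is chosen to be regular towards all later sets and towards the red
    -- neighbourhoods of almost all vertices in them; the exceptional vertices are deleted. Passing
    -- to neighbours of v with one label then shrinks a later set and the red neighbourhoods inside
    -- it by about the same factor L, so their ratio hardly changes.
    embed : ∀ m → m ≤ n → ∀ h → (∀ i j → h i j < B) → ∀ W →
      (∀ i → i < m → Y * (2 * L) ^ m ≤ ∣ W i ∣ˢ) →
      (∀ i j → i < j → j < m → ∀ x → W i x ≡ true → scale m * deg R x (W j) ≤ ∣ W j ∣ˢ) →
      Copy m E h W
    embed zero    _    h h<B W big sparse = (λ _ → 0) , (λ _ ()) , (λ _ _ _ ())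
    embed (suc m) 1+m≤n h h<B W big sparse = extend {E = E} {h} {W} {W′} v<N v∈W₀
        (λ i _ e → ∧-true⁻ (proj₁ (∧-true⁻ e)))
        (embed m m≤n (λ i j → h (suc i) (suc j)) (λ i j → h<B (suc i) (suc j)) W′ big′ sparse′)
      where
      open ≤-Reasoning
      m≤n : m ≤ n
      m≤n = ≤-trans (n≤1+n m) 1+m≤n
      V : ℕ → Subset
      V i = W (suc i)
      τ : ℕ → ℕ
      τ j = colour (h 0 (suc j))
      τ<L : ∀ j → τ j < L
      τ<L j = colour<L (h<B 0 (suc j))
      RV : ℕ → ℕ → Subset
      RV b j x = R b x ∧ V j x
      bad : ℕ → ℕ → ℕ → Subset
      bad v i j b = V i b ∧ irregular (τ j) (RV b j) v
      -- A single irregular later set already costs F. Hence a cost below F excludes these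
      -- altogether and leaves fewer than F vertices to delete.
      costV costR cost : ℕ → ℕ
      costV v = ∑ m (λ j → F * ⟦ irregular (τ j) (V j) v ⟧)
      costR v = ∑ m (λ i → ∑ m (λ j → ∣ bad v i j ∣ˢ))
      cost v = costV v + costR v

      Y≤ : ∀ i → i < suc m → Y ≤ ∣ W i ∣ˢ
      Y≤ i p = ≤-trans (Y≤Y*pow (suc m)) (big i p)

      ∑-bad : ∀ i j → ∑ N (λ v → ∣ bad v i j ∣ˢ) ≤ N * β
      ∑-bad i j = ≤-trans (≤-reflexive (∑-swap N N (λ v b → ⟦ bad v i j b ⟧)))
        (∑-≤ N β (λ b _ → ≤-trans (∑-mono N (λ v _ → ⟦⟧-mono (bad v i j b) (irregular (τ j) (RV b j) v) (λ e → proj₂ (∧-true⁻ {V i b} e)))) (regular (τ<L j) (RV b j))))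

      ∑-cost : ∑ N cost ≤ n * (F * β) + n * (n * (N * β))
      ∑-cost = begin
        ∑ N cost                              ≡⟨ ∑-+ N costV costR ⟩
        ∑ N costV + ∑ N costR                 ≡⟨ cong₂ _+_ (∑-swap N m _) (trans (∑-swap N m _) (∑-cong m (λ i _ → ∑-swap N m (λ v j → ∣ bad v i j ∣ˢ)))) ⟩
        ∑ m (λ j → ∑ N (λ v → F * ⟦ irregular (τ j) (V j) v ⟧)) + ∑ m (λ i → ∑ m (λ j → ∑ N (λ v → ∣ bad v i j ∣ˢ)))
          ≤⟨ +-mono-≤ (∑-≤ m (F * β) (λ j _ → ≤-trans (≤-reflexive (∑-*ˡ N F _)) (*-monoʳ-≤ F (regular (τ<L j) (V j)))))
                      (∑-≤ m (m * (N * β)) (λ i _ → ∑-≤ m (N * β) (λ j _ → ∑-bad i j))) ⟩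
        m * (F * β) + m * (m * (N * β))       ≤⟨ +-mono-≤ (*-monoˡ-≤ (F * β) m≤n) (*-mono-≤ m≤n (*-monoˡ-≤ (N * β) m≤n)) ⟩
        n * (F * β) + n * (n * (N * β))       ∎

      choice : ∃[ v ] v < N × ⟦ W 0 v ⟧ * cost v < ⟦ W 0 v ⟧ * F
      choice = ∑-find N _ _ (begin-strict
        ∑ N (λ v → ⟦ W 0 v ⟧ * cost v)        ≤⟨ ∑-mono N (λ v _ → ≤-trans (*-monoˡ-≤ (cost v) (⟦⟧≤1 (W 0 v))) (≤-reflexive (*-identityˡ _))) ⟩
        ∑ N cost                              ≤⟨ ∑-cost ⟩
        n * (F * β) + n * (n * (N * β))       <⟨ exceptional ⟩
        F * Y                                 ≤⟨ *-monoʳ-≤ F (Y≤ 0 (s≤s z≤n)) ⟩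
        F * ∣ W 0 ∣ˢ                          ≡⟨ *-comm F _ ⟩
        ∣ W 0 ∣ˢ * F                          ≡⟨ sym (∑-*ʳ N F _) ⟩
        ∑ N (λ v → ⟦ W 0 v ⟧ * F)             ∎)

      v : ℕ
      v = proj₁ choice
      v<N : v < N
      v<N = proj₁ (proj₂ choice)
      v∈W₀ : W 0 v ≡ true
      v∈W₀ = proj₁ (⟦⟧-<⇒ (W 0 v) (proj₂ (proj₂ choice)))
      cost<F : cost v < F
      cost<F = proj₂ (⟦⟧-<⇒ (W 0 v) (proj₂ (proj₂ choice)))

      V-regular : ∀ j → j < m → ∣ L * deg (labelled (τ j)) v (V j) - ∣ V j ∣ˢ ∣ ≤ θ
      V-regular j j<m = <ᵇ-false⁻ (⟦⟧-<1 (irregular (τ j) (V j) v)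
        (*-cancelˡ-< F _ _ (begin-strict
          F * ⟦ irregular (τ j) (V j) v ⟧     ≤⟨ term≤∑ m (λ j → F * ⟦ irregular (τ j) (V j) v ⟧) j<m ⟩
          costV v                             ≤⟨ m≤m+n (costV v) (costR v) ⟩
          cost v                              <⟨ cost<F ⟩
          F                                   ≡⟨ sym (*-identityʳ F) ⟩
          F * 1                               ∎)))

      bads : ℕ → ℕ
      bads b = ∑ m (λ j → ⟦ irregular (τ j) (RV b j) v ⟧)

      W′ : ℕ → Subset
      W′ i x = (E (h 0 (suc i)) v x ∧ V i x) ∧ (bads x ≡ᵇ 0)

      -- The 1 accounts for v itself, which may lie in `V i` but is not its own blue neighbour.
      ∑-bads : ∀ i → i < m → 1 + ∑ N (λ x → ⟦ V i x ⟧ * bads x) ≤ F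
      ∑-bads i i<m = ≤-<-trans (begin
        ∑ N (λ x → ⟦ V i x ⟧ * bads x)        ≡⟨ ∑-cong N (λ x _ → trans (sym (∑-*ˡ m ⟦ V i x ⟧ _)) (∑-cong m (λ j _ → sym (⟦∧⟧ (V i x) _)))) ⟩
        ∑ N (λ x → ∑ m (λ j → ⟦ bad v i j x ⟧)) ≡⟨ ∑-swap N m _ ⟩
        ∑ m (λ j → ∣ bad v i j ∣ˢ)            ≤⟨ term≤∑ m (λ i → ∑ m (λ j → ∣ bad v i j ∣ˢ)) i<m ⟩
        costR v                               ≤⟨ m≤n+m (costR v) (costV v) ⟩
        cost v                                ∎) cost<F

      pointwise : ∀ i x → ⟦ labelled (τ i) v x ∧ V i x ⟧ ≤ ⟦ W′ i x ⟧ + ⟦ R v x ∧ V i x ⟧ + (⟦ x ≡ᵇ v ⟧ + ⟦ V i x ⟧ * bads x)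
      pointwise i x = ⟦∧⟧-cover (label v x ≡ᵇ τ i) (V i x) (R v x) (x ≡ᵇ v) (bads x) (E (h 0 (suc i)) v x)
        (λ l r q → E-cover (h<B 0 (suc i)) (≡ᵇ-true⁻ l) r (λ v≡x → contradiction (trans (sym (≡ᵇ-true (sym v≡x))) q) (λ ())))

      hits≤ : ∀ i → i < m → deg (labelled (τ i)) v (V i) ≤ ∣ W′ i ∣ˢ + deg R v (V i) + F
      hits≤ i i<m = begin
        deg (labelled (τ i)) v (V i)
          ≤⟨ ∑-mono N (λ x _ → pointwise i x) ⟩
        ∑ N (λ x → ⟦ W′ i x ⟧ + ⟦ R v x ∧ V i x ⟧ + (⟦ x ≡ᵇ v ⟧ + ⟦ V i x ⟧ * bads x))
          ≡⟨ trans (∑-+ N _ _) (cong₂ _+_ (∑-+ N _ _) (∑-+ N _ _)) ⟩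
        ∣ W′ i ∣ˢ + deg R v (V i) + (∑ N (λ x → ⟦ x ≡ᵇ v ⟧) + ∑ N (λ x → ⟦ V i x ⟧ * bads x))
          ≡⟨ cong (λ z → ∣ W′ i ∣ˢ + deg R v (V i) + (z + ∑ N (λ x → ⟦ V i x ⟧ * bads x))) (∑-δ N v<N) ⟩
        ∣ W′ i ∣ˢ + deg R v (V i) + (1 + ∑ N (λ x → ⟦ V i x ⟧ * bads x))
          ≤⟨ +-monoʳ-≤ _ (∑-bads i i<m) ⟩
        ∣ W′ i ∣ˢ + deg R v (V i) + F ∎

      half : ∀ i → i < m → ∣ V i ∣ˢ ≤ 2 * L * ∣ W′ i ∣ˢ
      -- Three errors, from red neighbours, from deleted vertices and from the tolerance θ, take at
      -- most c / 8 each. This leaves 5 c / 8 of the expected share, of which c / 2 is claimed.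
      half i i<m = *-cancelˡ-≤ 4 (≤-trans (*-monoˡ-≤ c (n≤1+n 4)) (+-cancelʳ-≤ (3 * c) _ _ (begin
        5 * c + 3 * c                                   ≡⟨ sum₁ c ⟩
        8 * c                                           ≤⟨ *-monoʳ-≤ 8 (≤-∣-∣ c (L * H) (≤-trans (≤-reflexive (∣-∣-comm c (L * H))) (V-regular i i<m))) ⟩
        8 * (L * H + θ)                                 ≤⟨ *-monoʳ-≤ 8 (+-monoˡ-≤ θ (*-monoʳ-≤ L (hits≤ i i<m))) ⟩
        8 * (L * (w + D + F) + θ)                       ≡⟨ expand L w D F θ ⟩
        4 * (2 * L * w) + (8 * L * D + 8 * L * F + 8 * θ) ≤⟨ +-monoʳ-≤ (4 * (2 * L * w)) (+-mono-≤ (+-mono-≤ R-few (≤-trans F-small Y≤c)) θ-few) ⟩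
        4 * (2 * L * w) + (c + c + c)                   ≡⟨ cong (4 * (2 * L * w) +_) (sum₂ c) ⟩
        4 * (2 * L * w) + 3 * c                         ∎)))
        where
        c = ∣ V i ∣ˢ
        H = deg (labelled (τ i)) v (V i)
        w = ∣ W′ i ∣ˢ
        D = deg R v (V i)
        Y≤c : Y ≤ c
        Y≤c = Y≤ (suc i) (s≤s i<m)
        R-few : 8 * L * D ≤ c
        R-few = ≤-trans (*-monoˡ-≤ D (8L≤scale (suc m))) (sparse 0 (suc i) (s≤s z≤n) (s≤s i<m) v v∈W₀)
        θ-few : 8 * θ ≤ c
        θ-few = begin
          8 * θ          ≡⟨ *-comm 8 θ ⟩
          θ * 8          ≤⟨ *-monoʳ-≤ θ (≤-trans (m≤m*n 8 L) (8L≤scale n)) ⟩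
          θ * scale n    ≤⟨ θ-small ⟩
          Y              ≤⟨ Y≤c ⟩
          c              ∎
        sum₁ : ∀ c → 5 * c + 3 * c ≡ 8 * c
        sum₁ = solve-∀
        sum₂ : ∀ c → c + c + c ≡ 3 * c
        sum₂ = solve-∀
        expand : ∀ l w d f t → 8 * (l * (w + d + f) + t) ≡ 4 * (2 * l * w) + (8 * l * d + 8 * l * f + 8 * t)
        expand = solve-∀

      big′ : ∀ i → i < m → Y * (2 * L) ^ m ≤ ∣ W′ i ∣ˢ
      big′ i i<m = *-cancelˡ-≤ (2 * L) {{m*n≢0 2 L}} (begin
        2 * L * (Y * (2 * L) ^ m)     ≡⟨ swap (2 * L) Y _ ⟩
        Y * (2 * L) ^ suc m           ≤⟨ big (suc i) (s≤s i<m) ⟩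
        ∣ V i ∣ˢ                      ≤⟨ half i i<m ⟩
        2 * L * ∣ W′ i ∣ˢ             ∎)
        where
        swap : ∀ a b c → a * (b * c) ≡ b * (a * c)
        swap = solve-∀

      sparse′ : ∀ i j → i < j → j < m → ∀ x → W′ i x ≡ true → scale m * deg R x (W′ j) ≤ ∣ W′ j ∣ˢ
      -- The red neighbours of x in `W′ j` all have label `τ j` towards v, so regularity of v
      -- towards `RV x j` bounds them. The factor 4 between consecutive scales is 2 for the error θ
      -- times 2 for the possible loss in `half`.
      sparse′ i j i<j j<m x e = *-cancelˡ-≤ (4 * L) {{m*n≢0 4 L}} (begin
        4 * L * (scale m * deg R x (W′ j))       ≤⟨ *-monoʳ-≤ (4 * L) (*-monoʳ-≤ (scale m) R⊑H) ⟩
        4 * L * (scale m * H)                    ≡⟨ regroup L (4 ^ m) H ⟩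
        scale (suc m) * (L * H)                  ≤⟨ *-monoʳ-≤ (scale (suc m)) (≤-∣-∣ (L * H) D H-regular) ⟩
        scale (suc m) * (D + θ)                  ≡⟨ *-distribˡ-+ (scale (suc m)) D θ ⟩
        scale (suc m) * D + scale (suc m) * θ    ≤⟨ +-mono-≤ D-few θ-few ⟩
        ∣ V j ∣ˢ + ∣ V j ∣ˢ                      ≤⟨ +-mono-≤ (half j j<m) (half j j<m) ⟩
        2 * L * ∣ W′ j ∣ˢ + 2 * L * ∣ W′ j ∣ˢ    ≡⟨ sum L ∣ W′ j ∣ˢ ⟩
        4 * L * ∣ W′ j ∣ˢ                        ∎)
        where
        D = deg R x (V j)
        H = deg (labelled (τ j)) v (RV x j)
        regroup : ∀ l p h → 4 * l * (8 * l * p * h) ≡ 8 * l * (4 * p) * (l * h)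
        regroup = solve-∀
        sum : ∀ l w → 2 * l * w + 2 * l * w ≡ 4 * l * w
        sum = solve-∀
        x∈ : (E (h 0 (suc i)) v x ∧ V i x ≡ true) × (bads x ≡ᵇ 0) ≡ true
        x∈ = ∧-true⁻ e
        R⊑H : deg R x (W′ j) ≤ H
        R⊑H = card-mono {λ y → R x y ∧ W′ j y} {λ y → labelled (τ j) v y ∧ RV x j y} (λ {y} q →
          let (Rxy , W′y) = ∧-true⁻ {R x y} q
              (Evy , Vy)  = ∧-true⁻ {E (h 0 (suc j)) v y} (proj₁ (∧-true⁻ W′y))
          in ∧-true⁺ (≡ᵇ-true (E-label Evy)) (∧-true⁺ Rxy Vy))
        H-regular : ∣ L * H - D ∣ ≤ θ
        H-regular = <ᵇ-false⁻ (⟦⟧-<1 (irregular (τ j) (RV x j) v)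
          (s≤s (≤-trans (term≤∑ m (λ j → ⟦ irregular (τ j) (RV x j) v ⟧) j<m) (≤-reflexive (≡ᵇ-true⁻ (proj₂ x∈))))))
        D-few : scale (suc m) * D ≤ ∣ V j ∣ˢ
        D-few = sparse (suc i) (suc j) (s≤s i<j) (s≤s j<m) x (proj₂ (∧-true⁻ {E (h 0 (suc i)) v x} (proj₁ x∈)))
        θ-few : scale (suc m) * θ ≤ ∣ V j ∣ˢ
        θ-few = begin
          scale (suc m) * θ   ≡⟨ *-comm _ θ ⟩
          θ * scale (suc m)   ≤⟨ *-monoʳ-≤ θ (scale-mono 1+m≤n) ⟩
          θ * scale n         ≤⟨ θ-small ⟩
          Y                   ≤⟨ Y≤ (suc j) (s≤s j<m) ⟩
          ∣ V j ∣ˢ            ∎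

-- Sizes as powers of two, and the red-blue dichotomy

not-true⁻ : ∀ {b} → not b ≡ true → b ≡ false
not-true⁻ {false} _ = refl

not-true⁺ : ∀ b → ¬ (b ≡ true) → not b ≡ true
not-true⁺ false _ = refl
not-true⁺ true  f = contradiction refl f

2^-* : ∀ {x y} a b → x ≡ 2 ^ a → y ≡ 2 ^ b → x * y ≡ 2 ^ (a + b)
2^-* a b refl refl = sym (^-distribˡ-+-* 2 a b)

-- The sets of the sparse family have size 2 ^ (y + n (r + 1)), and those met while embedding the last colour
-- have size at least 2 ^ y; θ = 2 ^ e is the tolerance for degrees, violated at most 2 ^ b times.
record Parameters (n l : ℕ) : Set where
  field
    r s t t′ y e f b c : ℕ
    n≤2^l : n ≤ 2 ^ l
    r≡    : 2 * l * 2 ^ l ≡ r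
    t′≡   : 3 + r + 2 * n ≡ t′
    t≡    : 1 + l + t′ ≡ t
    e≡    : e + t′ ≡ y
    f≡    : 3 + r + f ≡ y
    b≡    : r + s + (r + s) + (r + r + (r + s + (r + s) + (r + s))) ≡ b + (e + e)
    c>    : l + (f + b) < c
    c≥    : l + (l + (r + s + (r + s) + b)) ≤ c
    c≡    : suc c ≡ f + y
    y≡    : l * (t * n + 1) + (y + n * (r + 1)) ≡ r + s + (r + s)

module Construction {n l : ℕ} (parameters : Parameters n l) where

  open Parameters parameters

  -- K is the number of leaves of the recursion. B is at least `n * n`, so the rank of an edge is a
  -- single digit, and L equals `B ^ K`, the number of strings of K digits.
  K B L : ℕ
  K = 2 ^ l
  B = 2 ^ (2 * l)
  L = 2 ^ r

  instance
    B≢0 : NonZero B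
    B≢0 = m^n≢0 2 (2 * l)
    L≢0 : NonZero L
    L≢0 = m^n≢0 2 r
    S≢0 : NonZero (2 ^ s)
    S≢0 = m^n≢0 2 s

  open Labelling L (2 ^ s) (congruence-solvable r s) public

  Q≡ : Q ≡ 2 ^ (r + s)
  Q≡ = 2^-* r s refl refl

  N≡ : N ≡ 2 ^ ((r + s) + (r + s))
  N≡ = 2^-* (r + s) (r + s) Q≡ Q≡

  open Graphs N public
  module Av = Avoiding N L label (2 ^ e) (2 ^ b) (2 ^ f) (2 ^ y) n

  regular : ∀ {τ} → τ < L → ∀ X → ∣ Av.irregular τ X ∣ˢ ≤ 2 ^ b
  regular {τ} τ<L X = *-cancelʳ-≤ _ _ (2 ^ e * 2 ^ e) {{m*n≢0 (2 ^ e) (2 ^ e) {{m^n≢0 2 e}} {{m^n≢0 2 e}}}} (begin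
    ∣ Av.irregular τ X ∣ˢ * (2 ^ e * 2 ^ e)      ≤⟨ chebyshev τ<L X (2 ^ e) ⟩
    N * (L * L * (Q * Q * Q))                    ≡⟨ 2^-* (r + s + (r + s)) (r + r + (r + s + (r + s) + (r + s))) N≡ (2^-* (r + r) (r + s + (r + s) + (r + s)) (2^-* r r refl refl) (2^-* (r + s + (r + s)) (r + s) (2^-* (r + s) (r + s) Q≡ Q≡) Q≡)) ⟩
    2 ^ (r + s + (r + s) + (r + r + (r + s + (r + s) + (r + s)))) ≡⟨ cong (2 ^_) b≡ ⟩
    2 ^ (b + (e + e))                            ≡⟨ sym (2^-* b (e + e) refl (2^-* e e refl refl)) ⟩
    2 ^ b * (2 ^ e * 2 ^ e)                      ∎)
    where open ≤-Reasoning

  scale≡ : Av.scale n ≡ 2 ^ t′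
  scale≡ = trans (2^-* (3 + r) (2 * n) (2^-* 3 r refl refl) (^-*-assoc 2 2 n)) (cong (2 ^_) t′≡)

  θ-small : 2 ^ e * Av.scale n ≤ 2 ^ y
  θ-small = ≤-reflexive (trans (2^-* e t′ refl scale≡) (cong (2 ^_) e≡))

  F-small : 8 * L * 2 ^ f ≤ 2 ^ y
  F-small = ≤-reflexive (trans (2^-* (3 + r) f (2^-* 3 r refl refl) refl) (cong (2 ^_) f≡))

  exceptional : n * (2 ^ f * 2 ^ b) + n * (n * (N * 2 ^ b)) < 2 ^ f * 2 ^ y
  exceptional = begin-strict
    n * (2 ^ f * 2 ^ b) + n * (n * (N * 2 ^ b))
      ≤⟨ +-mono-≤ (*-monoˡ-≤ (2 ^ f * 2 ^ b) n≤2^l) (*-mono-≤ n≤2^l (*-monoˡ-≤ (N * 2 ^ b) n≤2^l)) ⟩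
    2 ^ l * (2 ^ f * 2 ^ b) + 2 ^ l * (2 ^ l * (N * 2 ^ b))
      ≡⟨ cong₂ _+_ (2^-* l (f + b) refl (2^-* f b refl refl)) (2^-* l (l + (r + s + (r + s) + b)) refl (2^-* l (r + s + (r + s) + b) refl (2^-* (r + s + (r + s)) b N≡ refl))) ⟩
    2 ^ (l + (f + b)) + 2 ^ (l + (l + (r + s + (r + s) + b)))
      <⟨ +-mono-<-≤ (^-monoʳ-< 2 (s≤s (s≤s z≤n)) c>) (^-monoʳ-≤ 2 c≥) ⟩
    2 ^ c + 2 ^ c
      ≡⟨ cong (2 ^ c +_) (sym (+-identityʳ (2 ^ c))) ⟩
    2 ^ suc c
      ≡⟨ sym (trans (2^-* f y refl refl) (cong (2 ^_) (sym c≡))) ⟩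
    2 ^ f * 2 ^ y ∎
    where
    open ≤-Reasoning

  1≤2^ : ∀ a → 1 ≤ 2 ^ a
  1≤2^ a = m^n>0 2 a

  module Coloured (colour : ℕ → ℕ → Bool) (colour-sym : ∀ x y → colour x y ≡ colour y x) where

    Red : Edges
    Red x y = colour x y ∧ not (x ≡ᵇ y)

    Red-sym : ∀ x y → Red x y ≡ Red y x
    Red-sym x y = cong₂ (λ c d → c ∧ not d) (colour-sym x y) (≡ᵇ-comm x y)

    -- The digits h i j are read off the labels after a common prefix: m is a power of B and P a multiple of B.
    PatternCopy : Bool → (ℕ → ℕ → ℕ) → Set
    PatternCopy c h = Σ (ℕ → ℕ) λ g → (∀ i → i < n → g i < N) ×
      (∀ i j → i < j → j < n → colour (g i) (g j) ≡ c × g i ≢ g j) ×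
      ∃[ m ] Σ (NonZero m) λ m≢0 → ∃[ P ] (∀ i j → i < j → j < n → _/_ (label (g i) (g j)) m {{m≢0}} ≡ P + h i j)

    Universal : Bool → Set
    Universal c = ∀ h → (∀ i j → h i j < B) → PatternCopy c h

    module _ (h : ℕ → ℕ → ℕ) (h<B : ∀ i j → h i j < B) where

      private
        module Tr = Tree N B label label-sym Red Red-sym n h h<B K (Av.scale n) n≤2^l (1≤2^ l) (subst (1 ≤_) (sym scale≡) (1≤2^ t′))

      T₀≡ : Tr.T₀ ≡ 2 ^ t
      T₀≡ = trans (2^-* (1 + l) t′ refl scale≡) (cong (2 ^_) t≡)
      cost≡ : ∀ d a → Tr.cost d (2 ^ a) ≡ 2 ^ (d * (t * n + 1) + a)
      cost≡ zero    a = refl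
      cost≡ (suc d) a = trans (2^-* (t * n) (1 + (d * (t * n + 1) + a)) (trans (cong (_^ n) T₀≡) (^-*-assoc 2 t n)) (cong (2 *_) (cost≡ d a)))
                              (cong (2 ^_) (exps (t * n) (d * (t * n + 1)) a))
        where
        exps : ∀ u v a → u + (1 + (v + a)) ≡ u + 1 + v + a
        exps = solve-∀
      N-card : ∣ (λ _ → true) ∣ˢ ≡ N
      N-card = trans (∑-const N 1) (*-identityʳ N)
      cost≤N : Tr.cost l (2 ^ (y + n * (r + 1))) ≤ ∣ (λ _ → true) ∣ˢ
      cost≤N = ≤-reflexive (trans (cost≡ l (y + n * (r + 1))) (trans (cong (2 ^_) y≡) (sym (trans N-card N≡))))

      red : Tr.Found → PatternCopy true h
      red (ρ , P , g , g<N , g-edge) = g , (λ i p → proj₁ (g<N i p)) ,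
        (λ i j i<j j<n → let (red , _) = ∧-true⁻ {Red (g i) (g j)} (g-edge i j i<j j<n)
                             (c , ne) = ∧-true⁻ {colour (g i) (g j)} red
                         in c , (λ q → contradiction (trans (sym ne) (cong not (≡ᵇ-true q))) (λ ()))) ,
        B ^ ρ , m^n≢0 B ρ , P * B , (λ i j i<j j<n → ≡ᵇ-true⁻ (proj₂ (∧-true⁻ {Red (g i) (g j)} (g-edge i j i<j j<n))))

      module _ (F : Tr.SparseFamily l 1 0 (λ _ → true) (2 ^ (y + n * (r + 1)))) where

        open Tr.SparseFamily F

        -- A binary tree with 2 ^ d leaves has 2 ^ d - 1 internal nodes.
        depth≡ : ∀ d ρ → Tr.depth d ρ + 1 ≡ 2 ^ d + ρ
        depth≡ zero    ρ = +-comm ρ 1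
        depth≡ (suc d) ρ = begin
          suc (Tr.depth d (Tr.depth d ρ)) + 1    ≡⟨ cong suc (depth≡ d (Tr.depth d ρ)) ⟩
          suc (2 ^ d + Tr.depth d ρ)             ≡⟨ shuffle₁ (2 ^ d) (Tr.depth d ρ) ⟩
          2 ^ d + (Tr.depth d ρ + 1)             ≡⟨ cong (2 ^ d +_) (depth≡ d ρ) ⟩
          2 ^ d + (2 ^ d + ρ)                    ≡⟨ shuffle₂ (2 ^ d) ρ ⟩
          2 * 2 ^ d + ρ                          ∎
          where
          open ≡-Reasoning
          shuffle₁ : ∀ a b → suc (a + b) ≡ a + (b + 1)
          shuffle₁ = solve-∀
          shuffle₂ : ∀ a b → a + (a + b) ≡ 2 * a + b
          shuffle₂ = solve-∀
        L≡ : B ^ Tr.depth l 1 ≡ L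
        L≡ = trans (cong (B ^_) (+-cancelʳ-≡ 1 _ _ (depth≡ l 1))) (trans (^-*-assoc 2 (2 * l) (2 ^ l)) (cong (2 ^_) r≡))
        colour<L : ∀ {q} → q < B → P′ * B + q < L
        colour<L {q} q<B = begin-strict
          P′ * B + q                    <⟨ +-monoʳ-< (P′ * B) q<B ⟩
          P′ * B + B                    ≡⟨ +-comm (P′ * B) B ⟩
          suc P′ * B                    ≡⟨ cong (suc P′ *_) (sym (*-identityʳ B)) ⟩
          suc P′ * B ^ 1                ≤⟨ Tr.Refines.bound refines ⟩
          1 * B ^ Tr.depth l 1          ≡⟨ trans (*-identityˡ _) L≡ ⟩
          L                             ∎
          where open ≤-Reasoning
        Blue : ℕ → Edges
        Blue q x y = not (colour x y) ∧ (not (x ≡ᵇ y) ∧ (label x y ≡ᵇ P′ * B + q))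
        R : Edges
        R = Tr.E 1 P′
        blue-label : ∀ {q x y} → Blue q x y ≡ true → label x y ≡ P′ * B + q
        blue-label {q} {x} {y} e = ≡ᵇ-true⁻ (proj₂ (∧-true⁻ {not (x ≡ᵇ y)} (proj₂ (∧-true⁻ {not (colour x y)} e))))
        -- A label continuing `P′` by one digit has prefix `P′`, so any red edge carrying it belongs
        -- to R.
        blue-cover : ∀ {q x y} → q < B → label x y ≡ P′ * B + q → R x y ≡ false → x ≢ y → Blue q x y ≡ true
        blue-cover {q} {x} {y} q<B lab nonred x≢y = ∧-true⁺ not-red (∧-true⁺ (cong not (≡ᵇ-false x≢y)) (≡ᵇ-true lab))
          where
          pre : Tr.prefix 1 (label x y) ≡ P′
          pre = Tr.prefix-suc {0} q<B (trans (n/1≡n (label x y)) lab)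
          not-red : not (colour x y) ≡ true
          not-red = not-true⁺ (colour x y) (λ c → contradiction (trans (sym nonred) (∧-true⁺ (∧-true⁺ c (cong not (≡ᵇ-false x≢y))) (≡ᵇ-true pre))) (λ ()))
        size : ∀ i → i < n → 2 ^ y * (2 * L) ^ n ≤ ∣ sets i ∣ˢ
        size i i<n = ≤-trans (≤-reflexive (2^-* y (n * (r + 1)) refl (trans (^-*-assoc 2 (suc r) n) (cong (2 ^_) (trans (*-comm (suc r) n) (cong (n *_) (+-comm 1 r)))))))
                             (large i (≤-trans i<n n≤2^l))

        blue-pattern : ∀ {h′} → Copy n Blue h′ sets → PatternCopy false h′
        blue-pattern {h′} (g , g<N , g-edge) = g , (λ i p → proj₁ (g<N i p)) ,
          (λ i j i<j j<n → let (c , rest) = ∧-true⁻ {not (colour (g i) (g j))} (g-edge i j i<j j<n)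
                               (ne , _) = ∧-true⁻ {not (g i ≡ᵇ g j)} rest
                           in not-true⁻ c , (λ q → contradiction (trans (sym ne) (cong not (≡ᵇ-true q))) (λ ()))) ,
          1 , _ , P′ * B , (λ i j i<j j<n → trans (n/1≡n (label (g i) (g j))) (blue-label {h′ i j} {g i} {g j} (g-edge i j i<j j<n)))

        blue : Universal false
        blue h′ h′<B = blue-pattern {h′} (Av.embed regular exceptional θ-small F-small B (λ q → P′ * B + q) colour<L R Blue
          (λ {q} {u} {v} → blue-label {q} {u} {v}) (λ {q} {u} {v} → blue-cover {q} {u} {v}) n ≤-refl h′ h′<B sets size (λ i j i<j j<n → sparse i j i<j (≤-trans j<n n≤2^l)))

      -- Failure for one red pattern makes blue universal. At the root the prefix is empty and all 2
      -- ^ l digits are free; the final 1 reserves the last digit for blue.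
      dichotomy : PatternCopy true h ⊎ Universal false
      dichotomy = Sum.map red blue (Tr.tree l 1 0 (λ _ → true) (2 ^ (y + n * (r + 1))) ≤-refl (1≤2^ (y + n * (r + 1))) cost≤N)

-- From patterns to edge-ordered graphs

-- Constructive finite search: as Q does not depend on a, either every a yields its P or some a
-- yields Q. Here Q is universality of blue.
Exhaustible : Set → Set₁
Exhaustible A = ∀ {P : A → Set} {Q : Set} → (∀ a → P a ⊎ Q) → (∀ a → P a) ⊎ Q

Fin-exhaustible : ∀ k → Exhaustible (Fin k)
Fin-exhaustible zero    f = inj₁ (λ ())
Fin-exhaustible (suc k) f with f Fin.zero | Fin-exhaustible k (λ i → f (Fin.suc i))
... | inj₁ p | inj₁ ps = inj₁ (λ { Fin.zero → p ; (Fin.suc i) → ps i })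
... | inj₁ p | inj₂ q  = inj₂ q
... | inj₂ q | _       = inj₂ q

Vec-exhaustible : ∀ {A} → Exhaustible A → ∀ k → Exhaustible (Vec A k)
Vec-exhaustible ex zero    f = Sum.map₁ (λ { p [] → p }) (f [])
Vec-exhaustible ex (suc k) f = Sum.map₁ (λ { p (a ∷ as) → p a as }) (ex (λ a → Vec-exhaustible ex k (λ as → f (a ∷ as))))

lex-< : ∀ {m a a′ b} b′ → a < a′ → b < m → a * m + b < a′ * m + b′
lex-< {m} {a} {a′} {b} b′ a<a′ b<m = begin-strict
  a * m + b       <⟨ +-monoʳ-< (a * m) b<m ⟩
  a * m + m       ≡⟨ +-comm (a * m) m ⟩
  suc a * m       ≤⟨ *-monoˡ-≤ m a<a′ ⟩
  a′ * m          ≤⟨ m≤m+n (a′ * m) b′ ⟩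
  a′ * m + b′     ∎
  where open ≤-Reasoning

lex-injective : ∀ {m a a′ b b′} → b < m → b′ < m → a * m + b ≡ a′ * m + b′ → a ≡ a′ × b ≡ b′
lex-injective {m} {a} {a′} {b} {b′} b<m b′<m eq with <-cmp a a′
... | tri< a<a′ _ _ = contradiction eq (<⇒≢ (lex-< b′ a<a′ b<m))
... | tri> _ _ a′<a = contradiction (sym eq) (<⇒≢ (lex-< b a′<a b′<m))
... | tri≈ _ refl _ = refl , +-cancelˡ-≡ (a * m) b b′ eq

⊓⊔-injective : ∀ u v x y → u ⊓ v ≡ x ⊓ y → u ⊔ v ≡ x ⊔ y → (u ≡ x × v ≡ y) ⊎ (u ≡ y × v ≡ x)
⊓⊔-injective u v x y p q with ≤-total u v | ≤-total x y
... | inj₁ u≤v | inj₁ x≤y rewrite m≤n⇒m⊓n≡m u≤v | m≤n⇒m⊓n≡m x≤y | m≤n⇒m⊔n≡n u≤v | m≤n⇒m⊔n≡n x≤y = inj₁ (p , q)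
... | inj₁ u≤v | inj₂ y≤x rewrite m≤n⇒m⊓n≡m u≤v | m≥n⇒m⊓n≡n y≤x | m≤n⇒m⊔n≡n u≤v | m≥n⇒m⊔n≡m y≤x = inj₂ (p , q)
... | inj₂ v≤u | inj₁ x≤y rewrite m≥n⇒m⊓n≡n v≤u | m≤n⇒m⊓n≡m x≤y | m≥n⇒m⊔n≡m v≤u | m≤n⇒m⊔n≡n x≤y = inj₂ (q , p)
... | inj₂ v≤u | inj₂ y≤x rewrite m≥n⇒m⊓n≡n v≤u | m≥n⇒m⊓n≡n y≤x | m≥n⇒m⊔n≡m v≤u | m≥n⇒m⊔n≡m y≤x = inj₁ (q , p)

-- Many edges share a label. The endpoints, appended as two further digits in base M, break the ties
-- and make the edge labels distinct.
completeGraph : ∀ M (label : ℕ → ℕ → ℕ) → (∀ x y → label x y ≡ label y x) → EOGraph M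
completeGraph M label label-sym = record
  { adj     = λ u v → not (toℕ u ≡ᵇ toℕ v)
  ; adj-sym = λ u v → cong not (≡ᵇ-comm (toℕ u) (toℕ v))
  ; adj-irr = λ u → cong not (≡ᵇ-true {toℕ u} refl)
  ; lab     = λ u v → (label (toℕ u) (toℕ v) * M + (toℕ u ⊓ toℕ v)) * M + (toℕ u ⊔ toℕ v)
  ; lab-sym = λ u v → cong₂ (λ a b → a * M + b) (cong₂ (λ a b → a * M + b) (label-sym (toℕ u) (toℕ v)) (⊓-comm (toℕ u) (toℕ v))) (⊔-comm (toℕ u) (toℕ v))
  ; lab-inj = λ u v x y _ _ eq →
      let (eq′ , ⊔≡) = lex-injective {a = label (toℕ u) (toℕ v) * M + (toℕ u ⊓ toℕ v)} {label (toℕ x) (toℕ y) * M + (toℕ x ⊓ toℕ y)} (⊔-lub (toℕ<n u) (toℕ<n v)) (⊔-lub (toℕ<n x) (toℕ<n y)) eq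
          (_   , ⊓≡) = lex-injective {a = label (toℕ u) (toℕ v)} {label (toℕ x) (toℕ y)} (m≤n⇒m⊓o≤n _ (toℕ<n u)) (m≤n⇒m⊓o≤n _ (toℕ<n x)) eq′
      in Sum.map (λ (p , q) → toℕ-injective p , toℕ-injective q) (λ (p , q) → toℕ-injective p , toℕ-injective q)
           (⊓⊔-injective (toℕ u) (toℕ v) (toℕ x) (toℕ y) ⊓≡ ⊔≡)
  }

toℕ-mod : ∀ {m} .{{_ : NonZero m}} (u : Fin m) → toℕ u mod m ≡ u
toℕ-mod {m} u = toℕ-injective (trans (toℕ-fromℕ< (m%n<n (toℕ u) m)) (m<n⇒m%n≡m (toℕ<n u)))

module Rank {n} .{{_ : NonZero n}} (H : EOGraph n) where

  below : ℕ → ℕ → ℕ → Bool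
  below a i j = adj H (i mod n) (j mod n) ∧ (lab H (i mod n) (j mod n) <ᵇ a)

  -- Ordered pairs are counted, so each edge of smaller label contributes twice.
  rank : ℕ → ℕ
  rank a = ∑ n (λ i → ∑ n (λ j → ⟦ below a i j ⟧))

  0<n : 0 < n
  0<n = >-nonZero⁻¹ n

  rank<n*n : ∀ a → rank a < n * n
  rank<n*n a = begin-strict
    -- Strictness comes from the pair (0 , 0), which is not an edge.
    rank a                        <⟨ ∑-strict n (λ i _ → ∑-mono n (λ j _ → ⟦⟧≤1 (below a i j))) 0<n
                                       (∑-strict n (λ j _ → ⟦⟧≤1 (below a 0 j)) 0<n
                                         (s≤s (≤-reflexive (cong (λ q → ⟦ q ∧ (lab H (0 mod n) (0 mod n) <ᵇ a) ⟧) (adj-irr H (0 mod n)))))) ⟩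
    ∑ n (λ i → ∑ n (λ j → 1))     ≡⟨ trans (∑-cong n (λ _ _ → trans (∑-const n 1) (*-identityʳ n))) (∑-const n n) ⟩
    n * n                         ∎
    where open ≤-Reasoning

  -- The edge uv is counted below a, but not below its own label.
  rank-mono : ∀ u v → adj H u v ≡ true → ∀ {a} → lab H u v < a → rank (lab H u v) < rank a
  rank-mono u v uv {a} lt = ∑-strict n (λ i _ → ∑-mono n (λ j _ → mono i j)) (toℕ<n u) (∑-strict n (λ j _ → mono (toℕ u) j) (toℕ<n v) strict)
    where
    mono : ∀ i j → ⟦ below (lab H u v) i j ⟧ ≤ ⟦ below a i j ⟧
    mono i j = ⟦⟧-mono (below (lab H u v) i j) (below a i j) (λ e → let (p , q) = ∧-true⁻ {adj H (i mod n) (j mod n)} e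
      in ∧-true⁺ p (<ᵇ-true⁺ (<-trans (<ᵇ-true⁻ q) lt)))
      where
      <ᵇ-true⁺ : ∀ {m n} → m < n → (m <ᵇ n) ≡ true
      <ᵇ-true⁺ {zero}  {suc n} _       = refl
      <ᵇ-true⁺ {suc m} {suc n} (s≤s p) = <ᵇ-true⁺ p
    strict : ⟦ below (lab H u v) (toℕ u) (toℕ v) ⟧ < ⟦ below a (toℕ u) (toℕ v) ⟧
    strict rewrite toℕ-mod u | toℕ-mod v | uv with lab H u v <ᵇ lab H u v in e₁ | lab H u v <ᵇ a in e₂
    ... | true  | _     = contradiction (<ᵇ-true⁻ {lab H u v} e₁) (<-irrefl refl)
    ... | false | true  = s≤s z≤n
    ... | false | false = contradiction lt (≤⇒≯ (<ᵇ-false⁻ e₂))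

adj⇒≢ : ∀ {n} (H : EOGraph n) {u v} → adj H u v ≡ true → u ≢ v
adj⇒≢ H {u} uv refl = contradiction (trans (sym uv) (adj-irr H u)) (λ ())

module Assembly {n l : ℕ} .{{_ : NonZero n}} (parameters : Parameters n l) (M : ℕ) where

  open Construction parameters
  open Parameters parameters using (n≤2^l; r; s)

  -- The arithmetic labelling extends to all numbers, so the host can have any M ≥ N vertices; the
  -- copies are found among the first N.
  G : EOGraph M
  G = completeGraph M label label-sym

  lab-< : ∀ u v x y → label (toℕ u) (toℕ v) < label (toℕ x) (toℕ y) → lab G u v < lab G x y
  lab-< u v x y lt = lex-< (toℕ x ⊔ toℕ y) (lex-< (toℕ x ⊓ toℕ y) lt (m≤n⇒m⊓o≤n _ (toℕ<n u))) (⊔-lub (toℕ<n u) (toℕ<n v))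

  Pattern : Set
  Pattern = Vec (Vec (Fin B) n) n

  entry : Pattern → ℕ → ℕ → ℕ
  entry p i j = toℕ (lookup (lookup p (i mod n)) (j mod n))

  n*n≤B : n * n ≤ B
  n*n≤B = ≤-trans (*-mono-≤ n≤2^l n≤2^l) (≤-reflexive (2^-* l (l + 0) refl (cong (2 ^_) (sym (+-identityʳ l)))))

  -- Non-adjacent pairs also receive a digit. A copy of the pattern is thus a monochromatic clique,
  -- and H is found as a subgraph of it.
  pattern-of : EOGraph n → Pattern
  pattern-of H = tabulate (λ u → tabulate (λ v → fromℕ< (<-≤-trans (Rank.rank<n*n H (lab H u v)) n*n≤B)))

  pattern-of-rank : ∀ H u v → entry (pattern-of H) (toℕ u) (toℕ v) ≡ Rank.rank H (lab H u v)
  pattern-of-rank H u v = begin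
    toℕ (lookup (lookup (pattern-of H) (toℕ u mod n)) (toℕ v mod n))
      ≡⟨ cong₂ (λ u v → toℕ (lookup (lookup (pattern-of H) u) v)) (toℕ-mod u) (toℕ-mod v) ⟩
    toℕ (lookup (lookup (pattern-of H) u) v)
      ≡⟨ cong (λ row → toℕ (lookup row v)) (lookup∘tabulate _ u) ⟩
    toℕ (lookup (tabulate (λ v → fromℕ< (<-≤-trans (Rank.rank<n*n H (lab H u v)) n*n≤B))) v)
      ≡⟨ cong toℕ (lookup∘tabulate _ v) ⟩
    toℕ (fromℕ< (<-≤-trans (Rank.rank<n*n H (lab H u v)) n*n≤B))
      ≡⟨ toℕ-fromℕ< _ ⟩
    Rank.rank H (lab H u v) ∎
    where open ≡-Reasoning

  module _ (N≤M : N ≤ M) (c : TwoColouring M) where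

    instance
      M≢0 : NonZero M
      M≢0 = >-nonZero (≤-trans (subst (1 ≤_) (sym N≡) (m^n>0 2 (r + s + (r + s)))) N≤M)

    open Coloured (λ x y → col c (x mod M) (y mod M)) (λ x y → col-sym c (x mod M) (y mod M))

    monochromatic : ∀ {b} H → PatternCopy b (entry (pattern-of H)) → MonoCopy G c b H
    monochromatic {b} H (g , g<N , g-edge , m , m≢0 , P , digit) =
      F , F-injective , (λ u v uv → F-adj u v (adj⇒≢ H uv)) , (λ u v uv → F-col u v (adj⇒≢ H uv)) , F-order
      where
      instance _ = m≢0
      F : Fin n → Fin M
      F u = g (toℕ u) mod M
      toℕ-F : ∀ u → toℕ (F u) ≡ g (toℕ u)
      toℕ-F u = trans (toℕ-fromℕ< (m%n<n (g (toℕ u)) M)) (m<n⇒m%n≡m (<-≤-trans (g<N (toℕ u) (toℕ<n u)) N≤M))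
      g-≢ : ∀ u v → u ≢ v → g (toℕ u) ≢ g (toℕ v)
      g-≢ u v u≢v eq with <-cmp (toℕ u) (toℕ v)
      ... | tri< lt _ _ = proj₂ (g-edge _ _ lt (toℕ<n v)) eq
      ... | tri≈ _ e _  = u≢v (toℕ-injective e)
      ... | tri> _ _ gt = proj₂ (g-edge _ _ gt (toℕ<n u)) (sym eq)
      F-injective : Injective _≡_ _≡_ F
      F-injective {u} {v} eq with u Fin.≟ v
      ... | yes e = e
      ... | no ne = contradiction (trans (sym (toℕ-F u)) (trans (cong toℕ eq) (toℕ-F v))) (g-≢ u v ne)
      F-adj : ∀ u v → u ≢ v → adj G (F u) (F v) ≡ true
      F-adj u v u≢v = cong not (≡ᵇ-false (λ e → g-≢ u v u≢v (trans (sym (toℕ-F u)) (trans e (toℕ-F v)))))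
      F-col : ∀ u v → u ≢ v → col c (F u) (F v) ≡ b
      F-col u v u≢v with <-cmp (toℕ u) (toℕ v)
      ... | tri< lt _ _ = proj₁ (g-edge _ _ lt (toℕ<n v))
      ... | tri≈ _ e _  = contradiction (toℕ-injective e) u≢v
      ... | tri> _ _ gt = trans (col-sym c (F u) (F v)) (proj₁ (g-edge _ _ gt (toℕ<n u)))
      F-digit : ∀ u v → u ≢ v → label (toℕ (F u)) (toℕ (F v)) / m ≡ P + Rank.rank H (lab H u v)
      F-digit u v u≢v with <-cmp (toℕ u) (toℕ v)
      ... | tri< lt _ _ = trans (cong₂ (λ x y → label x y / m) (toℕ-F u) (toℕ-F v))
                            (trans (digit _ _ lt (toℕ<n v)) (cong (P +_) (pattern-of-rank H u v)))
      ... | tri≈ _ e _  = contradiction (toℕ-injective e) u≢v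
      ... | tri> _ _ gt = trans (cong (_/ m) (trans (cong₂ label (toℕ-F u) (toℕ-F v)) (label-sym (g (toℕ u)) (g (toℕ v)))))
                            (trans (digit _ _ gt (toℕ<n u)) (cong (P +_) (trans (pattern-of-rank H v u) (cong (Rank.rank H) (lab-sym H v u)))))
      F-order : ∀ u v x y → adj H u v ≡ true → adj H x y ≡ true → lab H u v < lab H x y → lab G (F u) (F v) < lab G (F x) (F y)
      -- Dividing by m drops the digits after the one in use and is monotone, so a strict inequality
      -- between quotients forces one between labels.
      F-order u v x y uv xy lt = lab-< (F u) (F v) (F x) (F y) (≰⇒> (λ le → <⇒≱ quotients (/-monoˡ-≤ m le)))
        where
        quotients : label (toℕ (F u)) (toℕ (F v)) / m < label (toℕ (F x)) (toℕ (F y)) / m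
        quotients = subst₂ _<_ (sym (F-digit u v (adj⇒≢ H uv))) (sym (F-digit x y (adj⇒≢ H xy))) (+-monoʳ-< P (Rank.rank-mono H u v uv lt))

    universal-colour : ∃[ b ] (∀ (H : EOGraph n) → MonoCopy G c b H)
    universal-colour = Sum.[ (λ red → true , (λ H → monochromatic H (red (pattern-of H)))) ,
                             (λ blue → false , (λ H → monochromatic H (blue (entry (pattern-of H)) (λ i j → toℕ<n _)))) ]′
      (Vec-exhaustible (Vec-exhaustible (Fin-exhaustible B) n) n (λ p → dichotomy (entry p) (λ i j → toℕ<n _)))

universal-host : ∀ {n l} .{{_ : NonZero n}} (parameters : Parameters n l) → let open Parameters parameters in
  ∀ M → 2 ^ (r + s + (r + s)) ≤ M → ∃[ G ] (∀ (c : TwoColouring M) → ∃[ b ] (∀ (H : EOGraph n) → MonoCopy G c b H))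
universal-host parameters M large = G , universal-colour (≤-trans (≤-reflexive N≡) large)
  where
  open Assembly parameters M
  open Construction parameters using (N≡)

-- The number of vertices

-- The first hypothesis says that log₂ n ≥ a / b.
atMostN : ∀ n x a b .{{_ : NonZero b}} → 2 ^ a ≤ n ^ b → x * (b * b) ≤ 100 * (n * n) * (a * a) → AtMostN n (2 ^ x)
atMostN n x a b 2^a≤n^b bound p q 0<q n^q<2^p = begin
  (2 ^ x) ^ (q * q)                  ≡⟨ ^-*-assoc 2 x (q * q) ⟩
  2 ^ (x * (q * q))                  ≤⟨ ^-monoʳ-≤ 2 (*-cancelʳ-≤ (x * (q * q)) (100 * (n * n) * (p * p)) (b * b) {{m*n≢0 b b}} scaled) ⟩
  2 ^ (100 * (n * n) * (p * p))      ∎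
  where
  open ≤-Reasoning
  aq≤pb : a * q ≤ p * b
  aq≤pb = ≮⇒≥ λ lt → <⇒≱ (^-monoʳ-< 2 (s≤s (s≤s z≤n)) lt) (begin
    2 ^ (a * q)      ≡⟨ sym (^-*-assoc 2 a q) ⟩
    (2 ^ a) ^ q      ≤⟨ ^-monoˡ-≤ q 2^a≤n^b ⟩
    (n ^ b) ^ q      ≡⟨ ^-*-assoc n b q ⟩
    n ^ (b * q)      ≡⟨ cong (n ^_) (*-comm b q) ⟩
    n ^ (q * b)      ≡⟨ sym (^-*-assoc n q b) ⟩
    (n ^ q) ^ b      ≤⟨ ^-monoˡ-≤ b (<⇒≤ n^q<2^p) ⟩
    (2 ^ p) ^ b      ≡⟨ ^-*-assoc 2 p b ⟩
    2 ^ (p * b)      ∎)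
  arrange₁ : ∀ x q b → x * (q * q) * (b * b) ≡ x * (b * b) * (q * q)
  arrange₁ = solve-∀
  arrange₂ : ∀ c a q → c * (a * a) * (q * q) ≡ c * (a * q * (a * q))
  arrange₂ = solve-∀
  arrange₃ : ∀ c p b → c * (p * b * (p * b)) ≡ c * (p * p) * (b * b)
  arrange₃ = solve-∀
  scaled : x * (q * q) * (b * b) ≤ 100 * (n * n) * (p * p) * (b * b)
  scaled = begin
    x * (q * q) * (b * b)                      ≡⟨ arrange₁ x q b ⟩
    x * (b * b) * (q * q)                      ≤⟨ *-monoˡ-≤ (q * q) bound ⟩
    100 * (n * n) * (a * a) * (q * q)          ≡⟨ arrange₂ (100 * (n * n)) a q ⟩
    100 * (n * n) * (a * q * (a * q))          ≤⟨ *-monoʳ-≤ (100 * (n * n)) (*-mono-≤ aq≤pb aq≤pb) ⟩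
    100 * (n * n) * (p * b * (p * b))          ≡⟨ arrange₃ (100 * (n * n)) p b ⟩
    100 * (n * n) * (p * p) * (b * b)          ∎

AtMostN-mono : ∀ {n x y} → x ≤ y → AtMostN n y → AtMostN n x
AtMostN-mono x≤y atMost p q 0<q lt = ≤-trans (^-monoˡ-≤ (q * q) x≤y) (atMost p q 0<q lt)

≤-floor : ∀ {n M x} → IsFloorN n M → AtMostN n x → x ≤ M
≤-floor (_ , ¬atMost) atMost = ≮⇒≥ (λ lt → ¬atMost (AtMostN-mono lt atMost))

-- This is `r + s + (r + s)` for the s chosen in `parameters`. The argument r is kept free so that
-- `2 * l * 2 ^ l` can be replaced by a bound linear in n.
exponent : ℕ → ℕ → ℕ → ℕ
exponent n l r = 8 * (l * ((1 + l + (3 + r + 2 * n)) * n + 1) + n * (r + 1)) + 4 * l + 6 * r + 4 * (3 + r + 2 * n) + 8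

-- Once s is fixed, the equations, linear in the exponents, determine e, y, f, b and c. The s given
-- is the least for which `c≥` holds, and it holds with equality. Here z is the total loss, in
-- powers of two, of the recursion and of the blue embedding.
parameters : ∀ n l → n ≤ 2 ^ l → Parameters n l
parameters n l n≤2^l = record
  { r = r ; s = 4 * z + 2 * l + 2 * r + 2 * t′ + 4 ; t = 1 + l + t′ ; t′ = t′
  ; y = e + t′ ; e = e ; f = 7 * z + 4 * l + 5 * r + 4 * t′ + 5
  ; b = 6 * z + 2 * l + 5 * r + 4 * t′ + 4 ; c = 14 * z + 8 * l + 11 * r + 8 * t′ + 12
  ; n≤2^l = n≤2^l ; r≡ = refl ; t′≡ = refl ; t≡ = refl ; e≡ = refl
  ; f≡ = f≡ z l r t′ ; b≡ = b≡ z l r t′ ; c> = ≤-trans (m≤m+n _ (z + l + r + 2)) (≤-reflexive (c> z l r t′))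
  ; c≥ = ≤-reflexive (c≥ z l r t′) ; c≡ = c≡ z l r t′
  ; y≡ = y≡ (l * ((1 + l + t′) * n + 1)) (n * (r + 1)) l r t′
  }
  where
  r t′ z e : ℕ
  r  = 2 * l * 2 ^ l
  t′ = 3 + r + 2 * n
  z  = l * ((1 + l + t′) * n + 1) + n * (r + 1)
  e  = 7 * z + 4 * l + 6 * r + 3 * t′ + 8
  f≡ : ∀ z l r t → 3 + r + (7 * z + 4 * l + 5 * r + 4 * t + 5) ≡ 7 * z + 4 * l + 6 * r + 3 * t + 8 + t
  f≡ = solve-∀
  b≡ : ∀ z l r t → let s = 4 * z + 2 * l + 2 * r + 2 * t + 4
                       e = 7 * z + 4 * l + 6 * r + 3 * t + 8
                       b = 6 * z + 2 * l + 5 * r + 4 * t + 4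
                   in r + s + (r + s) + (r + r + (r + s + (r + s) + (r + s))) ≡ b + (e + e)
  b≡ = solve-∀
  c> : ∀ z l r t → let f = 7 * z + 4 * l + 5 * r + 4 * t + 5
                       b = 6 * z + 2 * l + 5 * r + 4 * t + 4
                   in 1 + (l + (f + b)) + (z + l + r + 2) ≡ 14 * z + 8 * l + 11 * r + 8 * t + 12
  c> = solve-∀
  c≥ : ∀ z l r t → let s = 4 * z + 2 * l + 2 * r + 2 * t + 4
                       b = 6 * z + 2 * l + 5 * r + 4 * t + 4
                   in l + (l + (r + s + (r + s) + b)) ≡ 14 * z + 8 * l + 11 * r + 8 * t + 12
  c≥ = solve-∀
  c≡ : ∀ z l r t → 1 + (14 * z + 8 * l + 11 * r + 8 * t + 12)
                 ≡ 7 * z + 4 * l + 5 * r + 4 * t + 5 + (7 * z + 4 * l + 6 * r + 3 * t + 8 + t)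
  c≡ = solve-∀
  y≡ : ∀ u v l r t → let z = u + v
                         s = 4 * z + 2 * l + 2 * r + 2 * t + 4
                         y = 7 * z + 4 * l + 6 * r + 3 * t + 8 + t
                     in u + (y + v) ≡ r + s + (r + s)
  y≡ = solve-∀

exponent≡ : ∀ n l (n≤2^l : n ≤ 2 ^ l) → let open Parameters (parameters n l n≤2^l) in r + s + (r + s) ≡ exponent n l (2 * l * 2 ^ l)
exponent≡ n l n≤2^l = identity (l * ((1 + l + (3 + 2 * l * 2 ^ l + 2 * n)) * n + 1) + n * (2 * l * 2 ^ l + 1)) l (2 * l * 2 ^ l) (3 + 2 * l * 2 ^ l + 2 * n)
  where
  identity : ∀ z l r t → let s = 4 * z + 2 * l + 2 * r + 2 * t + 4 in r + s + (r + s) ≡ 8 * z + 4 * l + 6 * r + 4 * t + 8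
  identity = solve-∀

exponent-mono : ∀ n l {r r′} → r ≤ r′ → exponent n l r ≤ exponent n l r′
exponent-mono n l r≤r′ = +-monoˡ-≤ 8 (+-mono-≤ (+-mono-≤ (+-monoˡ-≤ (4 * l) (*-monoʳ-≤ 8
  (+-mono-≤ (*-monoʳ-≤ l (+-monoˡ-≤ 1 (*-monoˡ-≤ n (+-monoʳ-≤ (1 + l) t′≤)))) (*-monoʳ-≤ n (+-monoˡ-≤ 1 r≤r′)))))
  (*-monoʳ-≤ 6 r≤r′)) (*-monoʳ-≤ 4 t′≤))
  where
  t′≤ = +-monoˡ-≤ (2 * n) (+-monoʳ-≤ 3 r≤r′)

log₂-bracket : ∀ n → 0 < n → ∃[ m ] 2 ^ m ≤ n × n < 2 ^ suc m
log₂-bracket 1 _ = 0 , s≤s z≤n , s≤s (s≤s z≤n)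
log₂-bracket (suc n@(suc _)) _ with log₂-bracket n (s≤s z≤n)
... | m , lo , hi with suc n <? 2 ^ suc m
...   | yes lt = m , m≤n⇒m≤1+n lo , lt
...   | no ¬lt = suc m , ≮⇒≥ ¬lt , ≤-<-trans hi (^-monoʳ-< 2 (s≤s (s≤s z≤n)) {suc m} {2 + m} ≤-refl)

-- After the substitution n = 9 + n′, m = 3 + m′ the difference of the two sides has nonnegative coefficients.
exponent-bound : ∀ n m → 9 ≤ n → 3 ≤ m → exponent n (suc m) (4 * suc m * n) ≤ 100 * (n * n) * (m * m)
exponent-bound n m 9≤n 3≤m with m≤n⇒∃[o]m+o≡n 9≤n | m≤n⇒∃[o]m+o≡n 3≤m
... | n , refl | m , refl = ≤-trans (m≤m+n _ _) (≤-reflexive (identity n m))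
  where
  identity : ∀ n m → 8 * ((4 + m) * ((1 + (4 + m) + (3 + 4 * (4 + m) * (9 + n) + 2 * (9 + n))) * (9 + n) + 1) + (9 + n) * (4 * (4 + m) * (9 + n) + 1))
      + 4 * (4 + m) + 6 * (4 * (4 + m) * (9 + n)) + 4 * (3 + 4 * (4 + m) * (9 + n) + 2 * (9 + n)) + 8
      + (68 * (n * n * (m * m)) + 296 * (n * n * m) + 196 * (n * n) + 1216 * (n * (m * m)) + 5192 * (n * m) + 3096 * n + 5436 * (m * m) + 22740 * m + 11920)
    ≡ 100 * ((9 + n) * (9 + n)) * ((3 + m) * (3 + m))
  identity = solve-∀

Admissible : ℕ → Set
Admissible n = ∃[ l ] n ≤ 2 ^ l × AtMostN n (2 ^ exponent n l (2 * l * 2 ^ l))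

-- For small n the inequality is verified by evaluation, with a / b a rational lower bound for log₂
-- n. The rounding down of log₂ n to an integer would be too coarse for n = 3 and n = 5.
admissible-check : ∀ n l a b .{{_ : NonZero b}} → T (n ≤ᵇ 2 ^ l) → T (2 ^ a ≤ᵇ n ^ b) →
  T (exponent n l (2 * l * 2 ^ l) * (b * b) ≤ᵇ 100 * (n * n) * (a * a)) → Admissible n
admissible-check n l a b p q r = l , ≤ᵇ⇒≤ n (2 ^ l) p , atMostN n (exponent n l (2 * l * 2 ^ l)) a b (≤ᵇ⇒≤ (2 ^ a) (n ^ b) q)
  (≤ᵇ⇒≤ (exponent n l (2 * l * 2 ^ l) * (b * b)) (100 * (n * n) * (a * a)) r)

admissible-large : ∀ n → 9 ≤ n → Admissible n
admissible-large n 9≤n with log₂-bracket n (≤-trans (s≤s z≤n) 9≤n)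
... | m , lo , hi = suc m , <⇒≤ hi , atMostN n (exponent n (suc m) (2 * suc m * 2 ^ suc m)) m 1 (≤-trans lo (≤-reflexive (sym (*-identityʳ n))))
        (≤-trans (≤-reflexive (*-identityʳ _)) (≤-trans (exponent-mono n (suc m) r≤) (exponent-bound n m 9≤n 3≤m)))
  where
  arrange : ∀ l p → 2 * l * (2 * p) ≡ 4 * l * p
  arrange = solve-∀
  r≤ : 2 * suc m * 2 ^ suc m ≤ 4 * suc m * n
  r≤ = ≤-trans (≤-reflexive (arrange (suc m) (2 ^ m))) (*-monoʳ-≤ (4 * suc m) lo)
  3≤m : 3 ≤ m
  3≤m = ≮⇒≥ (λ m<3 → <⇒≱ (<-≤-trans hi (^-monoʳ-≤ 2 m<3)) (≤-trans (n≤1+n 8) 9≤n))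

admissible : ∀ n → Admissible (2 + n)
admissible 0 = admissible-check 2 1 1 1 _ _ _
admissible 1 = admissible-check 3 2 3 2 _ _ _
admissible 2 = admissible-check 4 2 2 1 _ _ _
admissible 3 = admissible-check 5 3 9 4 _ _ _
admissible 4 = admissible-check 6 3 2 1 _ _ _
admissible 5 = admissible-check 7 3 2 1 _ _ _
admissible 6 = admissible-check 8 3 3 1 _ _ _
admissible (suc (suc (suc (suc (suc (suc (suc n))))))) = admissible-large (9 + n) (m≤m+n 9 n)

single-vertex : ∀ {M} (G : EOGraph M) → Fin M → (c : TwoColouring M) (H : EOGraph 1) → MonoCopy G c true H
single-vertex G v c H = (λ _ → v) , (λ { {Fin.zero} {Fin.zero} _ → refl }) , (λ x y e → contradiction e (no-edge x y)) ,
  (λ x y e → contradiction e (no-edge x y)) , (λ x y _ _ e → contradiction e (no-edge x y))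
  where
  no-edge : ∀ x y → adj H x y ≢ true
  no-edge Fin.zero Fin.zero e = contradiction (trans (sym e) (adj-irr H Fin.zero)) (λ ())

theorem2 : ∀ (n : ℕ) → 0 < n → ∀ (M : ℕ) → IsFloorN n M →
    ∃[ G ] (∀ (c : TwoColouring M) → ∃[ b ] (∀ (H : EOGraph n) → MonoCopy G c b H))
-- As log₂ 1 = 0, the bound leaves a single vertex, and a graph on one vertex has no edges to
-- colour.
theorem2 1 _ M floor = G , (λ c → true , single-vertex G (fromℕ< 0<M) c)
  where
  0<M : 0 < M
  0<M = ≤-floor floor (λ p q _ _ → ≤-trans (≤-reflexive (^-zeroˡ (q * q))) (m^n>0 2 (100 * (1 * 1) * (p * p))))
  G : EOGraph M
  G = completeGraph M (λ _ _ → 0) (λ _ _ → refl)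
theorem2 (suc (suc n)) _ M floor with admissible n
... | l , n≤2^l , atMost = universal-host (parameters (2 + n) l n≤2^l) M
  (≤-trans (≤-reflexive (cong (2 ^_) (exponent≡ (2 + n) l n≤2^l))) (≤-floor floor atMost))
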